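{- Let $n\ge2$ and let $\lambda$ be a Young diagram with $\ell(\lambda)<n$. Suppose that $\lambda$ is of hook shape or of two-column shape. Then, as maps on $\mathsf{SST}_n(\lambda)$, $$\mathsf{s}_i\cdot\mathsf{pr}^n=\mathsf{pr}^n\cdot\mathsf{s}_i\qquad\text{for all } i\in\{1,\dots,n-1\}.$$ In particular, $\mathsf{c}\cdot\mathsf{pr}^n=\mathsf{pr}^n\cdot\mathsf{c}$, where $\mathsf{c}=\mathsf{s}_1\mathsf{s}_2\cdots\mathsf{s}_{n-1}$.
   Context: Partitions are identified with Young diagrams (English convention); $\ell(\lambda)$ is the number of positive parts. Hook shape means $\lambda=(N-m,1^m)$ with $0\le m\le N-1$; two-column shape means that the diagram has two columns ($\lambda_1=2$). $\mathsf{SST}_n(\lambda)$ is the set of semistandard tableaux of shape $\lambda$ with entries in $\{1,\dots,n\}$ (rows weakly increasing, columns strictly increasing). Products of operators are compositions, rightmost applied first. Crystal reflections: for $1\le i\le n-1$, $\mathsf{s}_i$ acts on $T\in\mathsf{SST}_n(\lambda)$ as follows. Read the entries row by row, each row left to right, from the bottom row to the top row; regard each $i+1$ as "(" and each $i$ as ")" and match parentheses in the usual way; the unmatched letters form a subword $i^a(i+1)^b$, which $\mathsf{s}_i$ replaces by $i^b(i+1)^a$ in the same positions. (This is the Weyl group action from the standard $U_q(\mathfrak{sl}_n)$-crystal structure.) Promotion: for $T\in\mathsf{SST}_n(\lambda)$, $\mathsf{pr}(T)$ is obtained as follows. If $T$ has no entry $n$, add 1 to every entry. Otherwise replace each entry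 $n$ by a dot; process the dots from left to right, and slide each toward the northwest by jeu de taquin: repeatedly exchange the dot with the larger of the (non-dot) entries immediately above and immediately to the left of it (with the one above in case of equality, and with the only one available if just one exists), until there is no non-dot entry above or to the left. Finally add 1 to all remaining entries and replace all dots by 1. $\mathsf{pr}$ is a bijection of $\mathsf{SST}_n(\lambda)$. -}

module Defs where

open import Data.Bool using (Bool; true; false; if_then_else_)
open import Data.List
  using (List; []; _∷_; map; length; concat; reverse; foldr; foldl; filter;
         cartesianProduct; upTo; take; drop; head; replicate)
open import Data.List.Relation.Unary.All using (All)
open import Data.List.Relation.Unary.Linked using (Linked)
open import Data.Maybe using (Maybe; just; nothing; maybe′; _>>=_)
open import Data.Maybe.Properties using (≡-dec)
open import Data.Nat
open import Data.Nat.GeneralisedArithmetic using (iterate)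
open import Data.Product using (_×_; _,_; ∃₂)
open import Relation.Binary.PropositionalEquality using (_≡_)

------------------------------------------------------------------------
-- Partitions

-- Trailing zeros are excluded, so ℓ(λ) is `length`.
IsPartition : List ℕ → Set
IsPartition sh = Linked _≥_ sh × All (λ k → 1 ≤ k) sh

IsHook : List ℕ → Set
IsHook sh = ∃₂ λ N m → m < N × sh ≡ (N ∸ m) ∷ replicate m 1

IsTwoColumn : List ℕ → Set
IsTwoColumn sh = head sh ≡ just 2

------------------------------------------------------------------------
-- Semistandard tableaux

-- The list of rows, top row first.
Tableau : Set
Tableau = List (List ℕ)

-- Rows and columns are numbered from 0; `nothing` outside the diagram.
entry : {A : Set} → List (List A) → ℕ → ℕ → Maybe A
entry T r c = head (drop r T) >>= λ row → head (drop c row)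

record IsSST (n : ℕ) (sh : List ℕ) (T : Tableau) : Set where
  field
    shape   : map length T ≡ sh
    range   : All (All (λ x → 1 ≤ x × x ≤ n)) T
    rows    : All (Linked _≤_) T
    columns : ∀ r c x y → entry T r c ≡ just x → entry T (suc r) c ≡ just y →
              x < y

------------------------------------------------------------------------
-- Crystal reflections

-- A letter flagged `true` is an i or i+1 that is so far unmatched.
Flagged : Set
Flagged = List (ℕ × Bool)

-- Unflags the leftmost unmatched i; `nothing` if there is none.
closeFirst : ℕ → Flagged → Maybe Flagged
closeFirst i []                = nothing
closeFirst i ((x , false) ∷ w) = closeFirst i w >>= λ w′ → just ((x , false) ∷ w′)
closeFirst i ((x , true)  ∷ w) =
  if x ≡ᵇ i then just ((x , false) ∷ w)
  else (closeFirst i w >>= λ w′ → just ((x , true) ∷ w′))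

-- Each i+1 "(" , taken from right to left, is matched with the nearest
-- still unmatched i ")" to its right.
match : ℕ → List ℕ → Flagged
match i []      = []
match i (x ∷ w) =
  if x ≡ᵇ suc i
  then maybe′ (λ w′ → (x , false) ∷ w′) ((x , true) ∷ match i w)
              (closeFirst i (match i w))
  else ((x , (x ≡ᵇ i)) ∷ match i w)

countUnmatched : ℕ → Flagged → ℕ
countUnmatched j []                = 0
countUnmatched j ((x , false) ∷ w) = countUnmatched j w
countUnmatched j ((x , true)  ∷ w) =
  if x ≡ᵇ j then suc (countUnmatched j w) else countUnmatched j w

-- Rewrites the first b unmatched letters to i and all later ones to i+1.
refill : ℕ → ℕ → Flagged → List ℕ
refill i b       []                = []
refill i b       ((x , false) ∷ w) = x ∷ refill i b w
refill i zero    ((x , true)  ∷ w) = suc i ∷ refill i zero w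
refill i (suc b) ((x , true)  ∷ w) = i ∷ refill i b w

reflectWord : ℕ → List ℕ → List ℕ
reflectWord i w = refill i (countUnmatched (suc i) (match i w)) (match i w)

-- Cuts a word into consecutive blocks of the given lengths.
cut : List ℕ → List ℕ → List (List ℕ)
cut []       w = []
cut (k ∷ ks) w = take k w ∷ cut ks (drop k w)

s : ℕ → Tableau → Tableau
s i T = reverse (cut (map length (reverse T)) (reflectWord i (concat (reverse T))))

-- s 1 ∘ s 2 ∘ ⋯ ∘ s (n ∸ 1)
cox : ℕ → Tableau → Tableau
cox n T = foldr s T (map suc (upTo (n ∸ 1)))

------------------------------------------------------------------------
-- Promotion

-- A filling in which `nothing` is a dot.
Dotted : Set
Dotted = List (List (Maybe ℕ))

-- The number in a cell; `nothing` for a dot or outside the diagram.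
number : Dotted → ℕ → ℕ → Maybe ℕ
number g r c = entry g r c >>= λ x → x

modifyAt : {A : Set} → ℕ → (A → A) → List A → List A
modifyAt k       f []       = []
modifyAt zero    f (x ∷ xs) = f x ∷ xs
modifyAt (suc k) f (x ∷ xs) = x ∷ modifyAt k f xs

put : ℕ → ℕ → Maybe ℕ → Dotted → Dotted
put r c v = modifyAt r (modifyAt c (λ _ → v))

-- The dot at (r , c) moves into the cell above (resp. to the left), whose
-- number u moves into (r , c).
moveUp moveLeft : ℕ → ℕ → ℕ → Dotted → Dotted
moveUp   r c u g = put (pred r) c nothing (put r c (just u) g)
moveLeft r c u g = put r (pred c) nothing (put r c (just u) g)

-- Continues with the larger of the number above and the number to the left,
-- in case of equality with the one above; `stop` if there is neither.
larger : {A : Set} → Maybe ℕ → Maybe ℕ → A → (ℕ → A) → (ℕ → A) → A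
larger nothing  nothing  stop above left = stop
larger (just u) nothing  stop above left = above u
larger nothing  (just l) stop above left = left l
larger (just u) (just l) stop above left = if l ≤ᵇ u then above u else left l

-- Slides the dot at (r , c) until no number is above it or to its left.
slide : ℕ → ℕ → Dotted → Dotted
slide zero    zero    g = g
slide zero    (suc c) g = larger nothing (number g zero c) g
  (λ _ → g)
  (λ l → slide zero c (moveLeft zero (suc c) l g))
slide (suc r) zero    g = larger (number g r zero) nothing g
  (λ u → slide r zero (moveUp (suc r) zero u g))
  (λ _ → g)
slide (suc r) (suc c) g = larger (number g r (suc c)) (number g (suc r) c) g
  (λ u → slide r (suc c) (moveUp (suc r) (suc c) u g))
  (λ l → slide (suc r) c (moveLeft (suc r) (suc c) l g))

dotted : ℕ → Tableau → Dotted
dotted n = map (map (λ x → if x ≡ᵇ n then nothing else just x))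

-- The cells (column , row) with entry n, leftmost column first (in a
-- semistandard tableau, each column has at most one).
dots : ℕ → Tableau → List (ℕ × ℕ)
dots n T = filter (λ (c , r) → ≡-dec _≟_ (entry T r c) (just n))
  (cartesianProduct (upTo (foldr _⊔_ 0 (map length T))) (upTo (length T)))

-- If T has no entry n, there are no dots and this adds 1 to every entry.
pr : ℕ → Tableau → Tableau
pr n T = map (map (maybe′ suc 1))
  (foldl (λ g (c , r) → slide r c g) (dotted n T) (dots n T))

prⁿ : ℕ → Tableau → Tableau
prⁿ n T = iterate (pr n) T n

{-# OPTIONS --safe #-}
module Submission where

-- For both kinds of shapes a tableau amounts to its content c together with a word w
-- whose letters are attached to the letters of the tableau that occur (hooks: the
-- letters in the leg; two columns: the ballot word of the letters that lie in exactly
-- one column).  The reflection s i exchanges c_i and c_{i+1} and preserves w.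
-- Promotion rotates c and replaces w by φ w or w, where φ does not depend on c and is
-- applied exactly when the multiplicity of n is positive (hooks) or equal to 1 (two
-- columns).  So prⁿ preserves c and applies φ a number of times that is a symmetric
-- function of c, and this commutes with every s i.

open import Defs
open import Data.Bool using (Bool; true; false; if_then_else_; T; _xor_; _∧_)
open import Data.Empty using (⊥-elim)
open import Data.List
  using (List; []; _∷_; [_]; _++_; _ʳ++_; _∷ʳ_; map; length; concat; concatMap; reverse;
    replicate; take; drop; head; foldl; foldr; filter; cartesianProduct; applyUpTo;
    upTo)
open import Data.List.Properties
  using (++-cancelˡ; ∷-injectiveˡ; ∷-injectiveʳ; filter-++; filter-none; filter-accept;
    filter-reject; foldl-++; length-map; length-replicate; map-upTo; map-++;
    ++-identityʳ; ++-assoc; ++-ʳ++; length-++; unfold-reverse; reverse-++;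
    reverse-involutive; length-reverse; reverse-foldl; foldr-++; concatMap-++;
    concat-++; ʳ++-defn; reverse-map; map-∘; map-replicate; drop-[])
open import Data.List.Relation.Binary.Pointwise as Pointwise using (Pointwise; []; _∷_)
open import Data.List.Relation.Unary.All as All using (All; []; _∷_)
import Data.List.Relation.Unary.All.Properties as All
open import Data.List.Relation.Unary.Linked as Linked using (Linked; []; [-]; _∷_)
open import Data.List.Relation.Unary.Linked.Properties using (Linked⇒All)
open import Data.Maybe using (Maybe; just; nothing; maybe′)
open import Data.Maybe.Properties using (≡-dec)
import Data.Maybe.Relation.Binary.Pointwise as Maybe
open import Data.Nat
open import Data.Nat.GeneralisedArithmetic using (iterate)
open import Data.Nat.Properties
open import Data.Product using (_×_; _,_; proj₁; proj₂; ∃₂; ∃)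
open import Data.Sum using (_⊎_; inj₁; inj₂)
open import Data.Unit using (⊤; tt)
open import Function using (_∘_; const; flip; id)
open import Relation.Binary.PropositionalEquality hiding ([_])
open import Relation.Nullary using (yes; no)
open import Relation.Unary using (Decidable)

-- Reflections of words

-- A multiplicity leaves at most one binary choice of where the copies of a letter lie: in the leg
-- or not as soon as it is positive, first or second column only if it is 1. These choices, in the
-- order of the letters, form w; this is where the two conditions for applying φ come from. In a
-- hook the smallest letter that occurs is the corner entry, so its choice is forced; it is dropped,
-- and φ rotates the remaining choices. For two columns φ is the promotion of the standard tableau
-- with ballot word w. A single promotion moves every multiplicity to another letter. After n of
-- them each has been the last one exactly once and is back at its letter, and exchanging two
-- neighbouring multiplicities only reorders applications of maps that commute. What has to be
-- checked is therefore local: the effect of a reflection on two adjacent letters and the effect of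
-- promotion on the last letter.

≡ᵇ-refl : ∀ m → (m ≡ᵇ m) ≡ true
≡ᵇ-refl zero    = refl
≡ᵇ-refl (suc m) = ≡ᵇ-refl m

≢⇒≡ᵇ : ∀ m n → m ≢ n → (m ≡ᵇ n) ≡ false
≢⇒≡ᵇ zero    zero    m≢n = ⊥-elim (m≢n refl)
≢⇒≡ᵇ zero    (suc n) _   = refl
≢⇒≡ᵇ (suc m) zero    _   = refl
≢⇒≡ᵇ (suc m) (suc n) m≢n = ≢⇒≡ᵇ m n (m≢n ∘ cong suc)

1+n≡ᵇn : ∀ n → (suc n ≡ᵇ n) ≡ false
1+n≡ᵇn n = ≢⇒≡ᵇ (suc n) n 1+n≢n

n≡ᵇ1+n : ∀ n → (n ≡ᵇ suc n) ≡ false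
n≡ᵇ1+n n = ≢⇒≡ᵇ n (suc n) (1+n≢n ∘ sym)

data Letter (i : ℕ) : ℕ → Set where
  low   : Letter i i
  high  : Letter i (suc i)
  other : ∀ {x} → x ≢ i → x ≢ suc i → Letter i x

letter : ∀ i x → Letter i x
letter i x with x ≟ i | x ≟ suc i
... | yes refl | _        = low
... | no _     | yes refl = high
... | no x≢i   | no x≢1+i = other x≢i x≢1+i

-- Reflection is determined by the pattern of the letters i and i+1, here renamed to 0 and 1.
traceLetter : ℕ → ℕ → List ℕ
traceLetter i x =
  if x ≡ᵇ i then 0 ∷ [] else (if x ≡ᵇ suc i then 1 ∷ [] else [])

trace : ℕ → List ℕ → List ℕ
trace i = concatMap (traceLetter i)

traceLetter-low : ∀ i → traceLetter i i ≡ 0 ∷ []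
traceLetter-low i rewrite ≡ᵇ-refl i = refl

traceLetter-high : ∀ i → traceLetter i (suc i) ≡ 1 ∷ []
traceLetter-high i rewrite 1+n≡ᵇn i | ≡ᵇ-refl i = refl

traceLetter-other : ∀ {i x} → x ≢ i → x ≢ suc i → traceLetter i x ≡ []
traceLetter-other {i} {x} x≢i x≢1+i
  rewrite ≢⇒≡ᵇ x i x≢i | ≢⇒≡ᵇ x (suc i) x≢1+i = refl

Relevant : ℕ → ℕ → Set
Relevant i x = x ≡ i ⊎ x ≡ suc i

Agree : ℕ → ℕ → ℕ → Set
Agree i x y = x ≡ y ⊎ (Relevant i x × Relevant i y)

agree-refl : ∀ {i x} → Agree i x x
agree-refl = inj₁ refl

-- Euclidean form, because the reflected word and its proposed value are both compared with the same
-- original word.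
agree-euclidean : ∀ {i x y z} → Agree i x y → Agree i x z → Agree i y z
agree-euclidean (inj₁ refl)    xz             = xz
agree-euclidean (inj₂ (p , q)) (inj₁ refl)    = inj₂ (q , p)
agree-euclidean (inj₂ (p , q)) (inj₂ (_ , r)) = inj₂ (q , r)

agree-euclidean* : ∀ {i u v w} → Pointwise (Agree i) u v →
  Pointwise (Agree i) u w → Pointwise (Agree i) v w
agree-euclidean* []       []       = []
agree-euclidean* (p ∷ ps) (q ∷ qs) = agree-euclidean p q ∷ agree-euclidean* ps qs

traceLetter-injective : ∀ {i x y v w} → Relevant i x → Relevant i y →
  traceLetter i x ++ v ≡ traceLetter i y ++ w → x ≡ y
traceLetter-injective {i} (inj₁ refl) (inj₁ refl) eq = refl
traceLetter-injective {i} (inj₂ refl) (inj₂ refl) eq = refl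
traceLetter-injective {i} (inj₁ refl) (inj₂ refl) eq
  rewrite traceLetter-low i | traceLetter-high i with eq
... | ()
traceLetter-injective {i} (inj₂ refl) (inj₁ refl) eq
  rewrite traceLetter-low i | traceLetter-high i with eq
... | ()

-- Agreement fixes every letter outside i and i+1, and the trace lists the remaining ones in order,
-- so together they leave no freedom.
agree-unique : ∀ {i v w} → Pointwise (Agree i) v w → trace i v ≡ trace i w → v ≡ w
agree-unique []       eq = refl
agree-unique {i} {x ∷ v} (inj₁ refl ∷ ps) eq =
  cong (x ∷_) (agree-unique ps (++-cancelˡ (traceLetter i x) _ _ eq))
agree-unique {i} {x ∷ v} (inj₂ (p , q) ∷ ps) eq with traceLetter-injective p q eq
... | refl = cong (x ∷_) (agree-unique ps (++-cancelˡ (traceLetter i x) _ _ eq))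

-- Marked i w F G: the marking F of w and the marking G of trace i w correspond.
data Marked (i : ℕ) : List ℕ → Flagged → Flagged → Set where
  []    : Marked i [] [] []
  other : ∀ {x w F G} → x ≢ i → x ≢ suc i → Marked i w F G →
          Marked i (x ∷ w) ((x , false) ∷ F) G
  low   : ∀ {w F G b} → Marked i w F G → Marked i (i ∷ w) ((i , b) ∷ F) ((0 , b) ∷ G)
  high  : ∀ {w F G b} → Marked i w F G →
          Marked i (suc i ∷ w) ((suc i , b) ∷ F) ((1 , b) ∷ G)

-- A letter other than i and i+1 carries the flag `false`, so the search for a closing bracket
-- passes over it as if it were absent.
closeFirst-marked : ∀ {i w F G} → Marked i w F G →
  Maybe.Pointwise (Marked i w) (closeFirst i F) (closeFirst 0 G)
closeFirst-marked [] = Maybe.nothing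
closeFirst-marked {i} (other {F = F} {G} p q m)
  with closeFirst i F | closeFirst 0 G | closeFirst-marked m
... | _ | _ | Maybe.just m′ = Maybe.just (other p q m′)
... | _ | _ | Maybe.nothing = Maybe.nothing
closeFirst-marked {i} (low {F = F} {G} {false} m)
  with closeFirst i F | closeFirst 0 G | closeFirst-marked m
... | _ | _ | Maybe.just m′ = Maybe.just (low m′)
... | _ | _ | Maybe.nothing = Maybe.nothing
closeFirst-marked {i} (low {b = true} m) rewrite ≡ᵇ-refl i = Maybe.just (low m)
closeFirst-marked {i} (high {F = F} {G} {false} m)
  with closeFirst i F | closeFirst 0 G | closeFirst-marked m
... | _ | _ | Maybe.just m′ = Maybe.just (high m′)
... | _ | _ | Maybe.nothing = Maybe.nothing
closeFirst-marked {i} (high {F = F} {G} {true} m) rewrite 1+n≡ᵇn i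
  with closeFirst i F | closeFirst 0 G | closeFirst-marked m
... | _ | _ | Maybe.just m′ = Maybe.just (high m′)
... | _ | _ | Maybe.nothing = Maybe.nothing

match-marked : ∀ i w → Marked i w (match i w) (match 0 (trace i w))
match-marked i []      = []
match-marked i (x ∷ w) with letter i x
... | low rewrite ≡ᵇ-refl i | n≡ᵇ1+n i = low (match-marked i w)
... | other p q rewrite ≢⇒≡ᵇ x i p | ≢⇒≡ᵇ x (suc i) q = other p q (match-marked i w)
... | high rewrite ≡ᵇ-refl i | 1+n≡ᵇn i
  with closeFirst i (match i w) | closeFirst 0 (match 0 (trace i w))
     | closeFirst-marked (match-marked i w)
... | _ | _ | Maybe.just m  = high m
... | _ | _ | Maybe.nothing = high (match-marked i w)

countUnmatched-marked : ∀ {i w F G} → Marked i w F G →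
  countUnmatched (suc i) F ≡ countUnmatched 1 G
countUnmatched-marked [] = refl
countUnmatched-marked (other _ _ m) = countUnmatched-marked m
countUnmatched-marked (low {b = false} m) = countUnmatched-marked m
countUnmatched-marked {i} (low {b = true} m) rewrite n≡ᵇ1+n i = countUnmatched-marked m
countUnmatched-marked (high {b = false} m) = countUnmatched-marked m
countUnmatched-marked {i} (high {b = true} m) rewrite ≡ᵇ-refl i =
  cong suc (countUnmatched-marked m)

refill-agree : ∀ {i w F G} b → Marked i w F G → Pointwise (Agree i) w (refill i b F)
refill-agree b       []                   = []
refill-agree b       (other _ _ m)        = agree-refl ∷ refill-agree b m
refill-agree b       (low  {b = false} m) = agree-refl ∷ refill-agree b m
refill-agree zero    (low  {b = true} m)  = inj₂ (inj₁ refl , inj₂ refl) ∷ refill-agree zero m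
refill-agree (suc b) (low  {b = true} m)  = agree-refl ∷ refill-agree b m
refill-agree b       (high {b = false} m) = agree-refl ∷ refill-agree b m
refill-agree zero    (high {b = true} m)  = agree-refl ∷ refill-agree zero m
refill-agree (suc b) (high {b = true} m)  = inj₂ (inj₂ refl , inj₁ refl) ∷ refill-agree b m

trace-refill : ∀ {i w F G} b → Marked i w F G → trace i (refill i b F) ≡ refill 0 b G
trace-refill b       [] = refl
trace-refill b       (other p q m) rewrite traceLetter-other p q = trace-refill b m
trace-refill {i} b       (low  {b = false} m) rewrite traceLetter-low i  =
  cong (0 ∷_) (trace-refill b m)
trace-refill {i} zero    (low  {b = true} m)  rewrite traceLetter-high i =
  cong (1 ∷_) (trace-refill zero m)
trace-refill {i} (suc b) (low  {b = true} m)  rewrite traceLetter-low i  =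
  cong (0 ∷_) (trace-refill b m)
trace-refill {i} b       (high {b = false} m) rewrite traceLetter-high i =
  cong (1 ∷_) (trace-refill b m)
trace-refill {i} zero    (high {b = true} m)  rewrite traceLetter-high i =
  cong (1 ∷_) (trace-refill zero m)
trace-refill {i} (suc b) (high {b = true} m)  rewrite traceLetter-low i  =
  cong (0 ∷_) (trace-refill b m)

-- Allows a proposed reflection to be verified on its trace, a word in 0 and 1 that no longer
-- depends on `i` or on the other letters.
reflectWord-unique : ∀ {i w w′} → Pointwise (Agree i) w w′ →
  trace i w′ ≡ reflectWord 0 (trace i w) → reflectWord i w ≡ w′
reflectWord-unique {i} {w} {w′} agree eq =
  agree-unique (agree-euclidean* (refill-agree b m) agree)
    (trans (trace-refill b m)
      (trans (cong (λ k → refill 0 k (match 0 (trace i w))) (countUnmatched-marked m)) (sym eq)))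
  where
  m = match-marked i w
  b = countUnmatched (suc i) (match i w)

-- From reading words back to tableaux

take-length-++ : ∀ {A : Set} (xs ys : List A) → take (length xs) (xs ++ ys) ≡ xs
take-length-++ []       ys = refl
take-length-++ (x ∷ xs) ys = cong (x ∷_) (take-length-++ xs ys)

drop-length-++ : ∀ {A : Set} (xs ys : List A) → drop (length xs) (xs ++ ys) ≡ ys
drop-length-++ []       ys = refl
drop-length-++ (x ∷ xs) ys = drop-length-++ xs ys

cut-concat : ∀ xss → cut (map length xss) (concat xss) ≡ xss
cut-concat []         = refl
cut-concat (xs ∷ xss) =
  cong₂ _∷_ (take-length-++ xs _)
    (trans (cong (cut (map length xss)) (drop-length-++ xs _)) (cut-concat xss))

readingWord : Tableau → List ℕ
readingWord T = concat (reverse T)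

map-length-pointwise : ∀ {R : ℕ → ℕ → Set} {T T′ : Tableau} →
  Pointwise (Pointwise R) T T′ → map length T ≡ map length T′
map-length-pointwise []       = refl
map-length-pointwise (p ∷ ps) =
  cong₂ _∷_ (Pointwise.Pointwise-length p) (map-length-pointwise ps)

-- Agreement also fixes the row lengths, so cutting the reading word of `T′` along the shape of `T`
-- gives back `T′`.
s-unique : ∀ {i T T′} → Pointwise (Pointwise (Agree i)) T T′ →
  trace i (readingWord T′) ≡ reflectWord 0 (trace i (readingWord T)) → s i T ≡ T′
s-unique {i} {T} {T′} agree eq = begin
  reverse (cut (map length (reverse T)) (reflectWord i (readingWord T)))
    ≡⟨ cong (reverse ∘ cut (map length (reverse T)))
      (reflectWord-unique (Pointwise.concat⁺ agreeʳ) eq) ⟩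
  reverse (cut (map length (reverse T)) (readingWord T′))
    ≡⟨ cong (λ ks → reverse (cut ks (readingWord T′))) (map-length-pointwise agreeʳ) ⟩
  reverse (cut (map length (reverse T′)) (readingWord T′))
    ≡⟨ cong reverse (cut-concat (reverse T′)) ⟩
  reverse (reverse T′)
    ≡⟨ reverse-involutive T′ ⟩
  T′ ∎
  where
  open ≡-Reasoning
  agreeʳ = Pointwise.reverse⁺ agree

-- Jeu de taquin slides

-- Fillings are built column by column, so that the cells a dot passes vertically are neighbours in
-- one list. Rows of the second argument beyond the new column are cut off.
attach : {A : Set} → List A → List (List A) → List (List A)
attach []       rs       = []
attach (x ∷ xs) []       = [ x ] ∷ attach xs []
attach (x ∷ xs) (r ∷ rs) = (x ∷ r) ∷ attach xs rs

map-attach : ∀ {A B : Set} (f : A → B) xs rs →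
  map (map f) (attach xs rs) ≡ attach (map f xs) (map (map f) rs)
map-attach f []       rs       = refl
map-attach f (x ∷ xs) []       = cong (_ ∷_) (map-attach f xs [])
map-attach f (x ∷ xs) (r ∷ rs) = cong (_ ∷_) (map-attach f xs rs)

length-attach : ∀ {A : Set} (xs : List A) rs → length (attach xs rs) ≡ length xs
length-attach []       rs       = refl
length-attach (x ∷ xs) []       = cong suc (length-attach xs [])
length-attach (x ∷ xs) (r ∷ rs) = cong suc (length-attach xs rs)

entry-attach-zero : ∀ {A : Set} (xs : List A) rs r →
  entry (attach xs rs) r 0 ≡ head (drop r xs)
entry-attach-zero []       rs       zero    = refl
entry-attach-zero []       rs       (suc r) = refl
entry-attach-zero (x ∷ xs) []       zero    = refl
entry-attach-zero (x ∷ xs) (_ ∷ rs) zero    = refl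
entry-attach-zero (x ∷ xs) []       (suc r) = entry-attach-zero xs [] r
entry-attach-zero (x ∷ xs) (_ ∷ rs) (suc r) = entry-attach-zero xs rs r

entry-[] : ∀ {A : Set} r c → entry {A} [] r c ≡ nothing
entry-[] zero    c = refl
entry-[] (suc r) c = refl

entry-attach-suc : ∀ {A : Set} (xs : List A) rs r c → length rs ≤ length xs →
  entry (attach xs rs) r (suc c) ≡ entry rs r c
entry-attach-suc []       []       r       c le = trans (entry-[] r (suc c)) (sym (entry-[] r c))
entry-attach-suc (x ∷ xs) []       zero    c le = cong head (drop-[] c)
entry-attach-suc (x ∷ xs) (_ ∷ rs) zero    c le = refl
entry-attach-suc (x ∷ xs) []       (suc r) c le =
  trans (entry-attach-suc xs [] r c z≤n) (entry-[] r c)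
entry-attach-suc (x ∷ xs) (_ ∷ rs) (suc r) c le = entry-attach-suc xs rs r c (s≤s⁻¹ le)

put-attach-zero : ∀ r v xs rs →
  put r 0 v (attach xs rs) ≡ attach (modifyAt r (const v) xs) rs
put-attach-zero zero    v []       rs       = refl
put-attach-zero (suc r) v []       rs       = refl
put-attach-zero zero    v (x ∷ xs) []       = refl
put-attach-zero zero    v (x ∷ xs) (_ ∷ rs) = refl
put-attach-zero (suc r) v (x ∷ xs) []       = cong (_ ∷_) (put-attach-zero r v xs [])
put-attach-zero (suc r) v (x ∷ xs) (_ ∷ rs) = cong (_ ∷_) (put-attach-zero r v xs rs)

put-attach-suc : ∀ r c v xs rs →
  put r (suc c) v (attach xs rs) ≡ attach xs (put r c v rs)
put-attach-suc zero    c v []       rs       = refl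
put-attach-suc (suc r) c v []       rs       = refl
put-attach-suc zero    c v (x ∷ xs) []       = refl
put-attach-suc zero    c v (x ∷ xs) (_ ∷ rs) = refl
put-attach-suc (suc r) c v (x ∷ xs) []       = cong (_ ∷_) (put-attach-suc r c v xs [])
put-attach-suc (suc r) c v (x ∷ xs) (_ ∷ rs) = cong (_ ∷_) (put-attach-suc r c v xs rs)

drop-ʳ++ : ∀ {A : Set} (us : List A) k ws → drop (length us + k) (us ʳ++ ws) ≡ drop k ws
drop-ʳ++ []       k ws = refl
drop-ʳ++ (u ∷ us) k ws rewrite sym (+-suc (length us) k) = drop-ʳ++ us (suc k) (u ∷ ws)

modifyAt-ʳ++ : ∀ {A : Set} (f : A → A) us k ws →
  modifyAt (length us + k) f (us ʳ++ ws) ≡ us ʳ++ modifyAt k f ws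
modifyAt-ʳ++ f []       k ws = refl
modifyAt-ʳ++ f (u ∷ us) k ws rewrite sym (+-suc (length us) k) =
  modifyAt-ʳ++ f us (suc k) (u ∷ ws)

head-drop-ʳ++ : ∀ {A : Set} (us : List A) k ws → length us ≡ k →
  head (drop k (us ʳ++ ws)) ≡ head ws
head-drop-ʳ++ us _ ws refl
  rewrite sym (+-identityʳ (length us)) = cong head (drop-ʳ++ us 0 ws)

modifyAt-head-ʳ++ : ∀ {A : Set} (f : A → A) us k ws → length us ≡ k →
  modifyAt k f (us ʳ++ ws) ≡ us ʳ++ modifyAt 0 f ws
modifyAt-head-ʳ++ f us _ ws refl =
  trans (cong (λ k → modifyAt k f (us ʳ++ ws)) (sym (+-identityʳ _))) (modifyAt-ʳ++ f us 0 ws)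

-- One exchange of the dot with its predecessor, in the order of `moveUp` and `moveLeft`: the number
-- is written over the dot first, then the dot over the number.
shift-ʳ++ : ∀ {A : Set} (us : List A) k u v x ws → length us ≡ k →
  modifyAt k (const v) (modifyAt (suc k) (const u) (us ʳ++ u ∷ x ∷ ws)) ≡ us ʳ++ v ∷ u ∷ ws
shift-ʳ++ us k u v x ws eq =
  trans (cong (modifyAt k (const v))
    (modifyAt-head-ʳ++ (const u) (u ∷ us) (suc k) (x ∷ ws) (cong suc eq)))
        (modifyAt-head-ʳ++ (const v) us k (u ∷ u ∷ ws) eq)

number-zero : ∀ xs rs r {v} → head (drop r xs) ≡ just v → number (attach xs rs) r 0 ≡ v
number-zero xs rs r eq rewrite entry-attach-zero xs rs r | eq = refl

-- The part of the column above the dot is stored reversed, nearest number first.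
slide-column : ∀ us xs rs →
  slide (length us) 0 (attach (map just us ʳ++ nothing ∷ xs) rs)
    ≡ attach (nothing ∷ (map just us ʳ++ xs)) rs
slide-column []       xs rs = refl
slide-column (u ∷ us) xs rs
  rewrite number-zero (map just us ʳ++ just u ∷ nothing ∷ xs) rs (length us)
            (head-drop-ʳ++ (map just us) (length us) _ (length-map just us))
        | put-attach-zero (suc (length us)) (just u) (map just us ʳ++ just u ∷ nothing ∷ xs) rs
        | put-attach-zero (length us) nothing
            (modifyAt (suc (length us)) (const (just u)) (map just us ʳ++ just u ∷ nothing ∷ xs)) rs
        | shift-ʳ++ (map just us) (length us) (just u) nothing nothing xs (length-map just us)
        = slide-column us (just u ∷ xs) rs

length-map-++-replicate : ∀ {A B : Set} (f : A → B) us j (x : B) →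
  length (map f us ++ replicate j x) ≡ length us + j
length-map-++-replicate f us j x =
  trans (length-++ (map f us)) (cong₂ _+_ (length-map f us) (length-replicate j))

-- In the top row the dot only moves left, and it stops at the `j` dots that have come to rest
-- there, since they are not numbers.
slide-row : ∀ j us xs G →
  slide 0 (length us + j) (((map just us ++ replicate j nothing) ʳ++ nothing ∷ xs) ∷ G)
    ≡ (replicate j nothing ʳ++ nothing ∷ (map just us ʳ++ xs)) ∷ G
slide-row zero    [] xs G = refl
slide-row (suc j) [] xs G
  rewrite head-drop-ʳ++ (replicate j nothing) j (nothing ∷ nothing {A = ℕ} ∷ xs)
    (length-replicate j)
  = refl
slide-row j (u ∷ us) xs G
  rewrite head-drop-ʳ++ (map just us ++ replicate j nothing) (length us + j)
            (just u ∷ nothing ∷ xs) (length-map-++-replicate just us j nothing)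
        | shift-ʳ++ (map just us ++ replicate j nothing) (length us + j) (just u) nothing nothing xs
            (length-map-++-replicate just us j nothing)
        = slide-row j us (just u ∷ xs) G

-- The entry of the first column in a row `k` not above `r` guarantees that `attach` has not cut off
-- row `r` of the second column.
number-one : ∀ {a : Maybe ℕ} (xs ys : List (Maybe ℕ)) r k {v} → r ≤ k →
  head (drop k xs) ≡ just a → head (drop r ys) ≡ just v →
  number (attach xs (attach ys [])) r 1 ≡ v
number-one []       ys       r       zero    r≤k () q
number-one []       ys       r       (suc k) r≤k () q
number-one (x ∷ xs) (y ∷ ys) zero    k       r≤k p refl = refl
number-one (x ∷ xs) (y ∷ ys) (suc r) (suc k) r≤k p q =
  number-one xs ys r k (s≤s⁻¹ r≤k) p q

≤⇒≤ᵇ-true : ∀ {m n} → m ≤ n → (m ≤ᵇ n) ≡ true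
≤⇒≤ᵇ-true {m} {n} m≤n with m ≤ᵇ n | ≤⇒≤ᵇ m≤n
... | true | _ = refl

<⇒≤ᵇ-false : ∀ {m n} → n < m → (m ≤ᵇ n) ≡ false
<⇒≤ᵇ-false {m} {n} n<m with m ≤ᵇ n in eq
... | false = refl
... | true  = ⊥-elim (<⇒≱ n<m (≤ᵇ⇒≤ m n (subst T (sym eq) tt)))

moveUp-one : ∀ r u xs ys → moveUp (suc r) 1 u (attach xs (attach ys []))
  ≡ attach xs (attach (modifyAt r (const nothing) (modifyAt (suc r) (const (just u)) ys)) [])
moveUp-one r u xs ys
  rewrite put-attach-suc (suc r) 0 (just u) xs (attach ys [])
        | put-attach-zero (suc r) (just u) ys []
        | put-attach-suc r 0 nothing xs (attach (modifyAt (suc r) (const (just u)) ys) [])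
        | put-attach-zero r nothing (modifyAt (suc r) (const (just u)) ys) []
  = refl

moveLeft-one : ∀ r l xs ys → moveLeft r 1 l (attach xs (attach ys []))
  ≡ attach (modifyAt r (const nothing) xs) (attach (modifyAt r (const (just l)) ys) [])
moveLeft-one r l xs ys
  rewrite put-attach-suc r 0 (just l) xs (attach ys [])
        | put-attach-zero r (just l) ys []
        | put-attach-zero r nothing xs (attach (modifyAt r (const (just l)) ys) [])
  = refl

-- A tie is decided for the number above, hence `≤` here and the strict inequality in
-- `slide-left-one`. The left neighbour `v` may itself be a dot, which never competes.
slide-up-one : ∀ r xs ys {u v} → head (drop (suc r) xs) ≡ just v →
  head (drop r ys) ≡ just (just u) → maybe′ (_≤ u) ⊤ v →
  slide (suc r) 1 (attach xs (attach ys []))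
    ≡ slide r 1 (attach xs
        (attach (modifyAt r (const nothing) (modifyAt (suc r) (const (just u)) ys)) []))
slide-up-one r xs ys {u} {nothing} left above le
  rewrite number-one xs ys r (suc r) (n≤1+n r) left above
        | number-zero xs (attach ys []) (suc r) left
        = cong (slide r 1) (moveUp-one r u xs ys)
slide-up-one r xs ys {u} {just l} left above le
  rewrite number-one xs ys r (suc r) (n≤1+n r) left above
        | number-zero xs (attach ys []) (suc r) left
        | ≤⇒≤ᵇ-true le
        = cong (slide r 1) (moveUp-one r u xs ys)

slide-left-top : ∀ xs ys {m} → head xs ≡ just (just m) →
  slide 0 1 (attach xs (attach ys []))
    ≡ slide 0 0 (attach (modifyAt 0 (const nothing) xs)
        (attach (modifyAt 0 (const (just m)) ys) []))
slide-left-top xs ys {m} left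
  rewrite number-zero xs (attach ys []) 0 left = cong (slide 0 0) (moveLeft-one 0 m xs ys)

slide-left-one : ∀ r xs ys {m v} → head (drop (suc r) xs) ≡ just (just m) →
  head (drop r ys) ≡ just v → maybe′ (_< m) ⊤ v →
  slide (suc r) 1 (attach xs (attach ys []))
    ≡ slide (suc r) 0 (attach (modifyAt (suc r) (const nothing) xs)
        (attach (modifyAt (suc r) (const (just m)) ys) []))
slide-left-one r xs ys {m} {nothing} left above lt
  rewrite number-one xs ys r (suc r) (n≤1+n r) left above
        | number-zero xs (attach ys []) (suc r) left
        = cong (slide (suc r) 0) (moveLeft-one (suc r) m xs ys)
slide-left-one r xs ys {m} {just u} left above lt
  rewrite number-one xs ys r (suc r) (n≤1+n r) left above
        | number-zero xs (attach ys []) (suc r) left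
        | <⇒≤ᵇ-false lt
        = cong (slide (suc r) 0) (moveLeft-one (suc r) m xs ys)

-- V lists the pairs (number to the left, number above) that the dot meets on its way up.
slide-climb : ∀ (hs ys : List (Maybe ℕ)) (V : List (ℕ × ℕ)) xs zs →
  length hs ≡ suc (length ys) → All (λ (x , y) → x ≤ y) V →
  slide (length V + length ys) 1
    (attach (hs ʳ++ (map (just ∘ proj₁) V ʳ++ xs))
      (attach (ys ʳ++ (map (just ∘ proj₂) V ʳ++ nothing ∷ zs)) []))
  ≡ slide (length ys) 1
      (attach (hs ʳ++ (map (just ∘ proj₁) V ʳ++ xs))
        (attach (ys ʳ++ nothing ∷ (map (just ∘ proj₂) V ʳ++ zs)) []))
slide-climb hs ys [] xs zs len [] = refl
slide-climb hs ys ((x , y) ∷ V) xs zs len (x≤y ∷ p) = begin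
  slide (suc r) 1 (attach left (attach right []))
    ≡⟨ slide-up-one r left right leftEntry aboveEntry x≤y ⟩
  slide r 1 (attach left (attach
    (modifyAt r (const nothing) (modifyAt (suc r) (const (just y)) right)) []))
    ≡⟨ cong (λ c → slide r 1 (attach left (attach c []))) shifted ⟩
  slide r 1 (attach left (attach (ys ʳ++ (map (just ∘ proj₂) V ʳ++ nothing ∷ just y ∷ zs)) []))
    ≡⟨ slide-climb hs ys V (just x ∷ xs) (just y ∷ zs) len p ⟩
  _ ∎
  where
  open ≡-Reasoning
  r = length V + length ys
  left = hs ʳ++ (map (just ∘ proj₁) V ʳ++ just x ∷ xs)
  right = ys ʳ++ (map (just ∘ proj₂) V ʳ++ just y ∷ nothing ∷ zs)
  nest : ∀ {A : Set} (us vs ws : List A) → us ʳ++ (vs ʳ++ ws) ≡ (vs ++ us) ʳ++ ws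
  nest us vs ws = sym (++-ʳ++ vs)
  nest-length : ∀ {A : Set} (us : List A) (f : (ℕ × ℕ) → A) →
    length (map f V ++ us) ≡ length V + length us
  nest-length us f = trans (length-++ (map f V)) (cong (_+ length us) (length-map f V))
  -- `hs` is one longer than `ys`: the number to the left of the dot lies one row below the number
  -- above the dot.
  leftEntry : head (drop (suc r) left) ≡ just (just x)
  leftEntry rewrite nest hs (map (just ∘ proj₁) V) (just x ∷ xs) =
    head-drop-ʳ++ (map (just ∘ proj₁) V ++ hs) (suc r) (just x ∷ xs)
      (trans (nest-length hs (just ∘ proj₁))
        (trans (cong (length V +_) len) (+-suc (length V) (length ys))))
  aboveEntry : head (drop r right) ≡ just (just y)
  aboveEntry rewrite nest ys (map (just ∘ proj₂) V) (just y ∷ nothing ∷ zs) =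
    head-drop-ʳ++ (map (just ∘ proj₂) V ++ ys) r _ (nest-length ys (just ∘ proj₂))
  shifted : modifyAt r (const nothing) (modifyAt (suc r) (const (just y)) right)
    ≡ ys ʳ++ (map (just ∘ proj₂) V ʳ++ nothing ∷ just y ∷ zs)
  shifted rewrite nest ys (map (just ∘ proj₂) V) (just y ∷ nothing ∷ zs)
                | nest ys (map (just ∘ proj₂) V) (nothing ∷ just y ∷ zs) =
    shift-ʳ++ (map (just ∘ proj₂) V ++ ys) r (just y) nothing nothing zs
      (nest-length ys (just ∘ proj₂))

-- The number `m` beats the number above, if there is one; once in the first column, the dot has
-- nothing to its left and rises to the top. The lengths agree because `m` lies in the row of the
-- dot.
slide-cross : ∀ us ys m xs zs → length us ≡ length ys → maybe′ (_< m) ⊤ (head ys) →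
  slide (length ys) 1
    (attach (map just us ʳ++ just m ∷ xs) (attach (map just ys ʳ++ nothing ∷ zs) []))
  ≡ attach (nothing ∷ (map just us ʳ++ xs)) (attach (map just ys ʳ++ just m ∷ zs) [])
slide-cross us ys m xs zs len lt = begin
  slide (length ys) 1 (attach left (attach right []))
    ≡⟨ go ys len lt ⟩
  slide (length ys) 0 (attach (modifyAt (length ys) (const nothing) left)
                        (attach (modifyAt (length ys) (const (just m)) right) []))
    ≡⟨ cong₂ (λ c d → slide (length ys) 0 (attach c (attach d [])))
         (modifyAt-head-ʳ++ (const nothing) (map just us) (length ys) _
           (trans (length-map just us) len))
         (modifyAt-head-ʳ++ (const (just m)) (map just ys) (length ys) _ (length-map just ys)) ⟩
  slide (length ys) 0 (attach (map just us ʳ++ nothing ∷ xs)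
    (attach (map just ys ʳ++ just m ∷ zs) []))
    ≡⟨ cong (λ k → slide k 0 (attach (map just us ʳ++ nothing ∷ xs)
      (attach (map just ys ʳ++ just m ∷ zs) []))) (sym len) ⟩
  slide (length us) 0 (attach (map just us ʳ++ nothing ∷ xs)
    (attach (map just ys ʳ++ just m ∷ zs) []))
    ≡⟨ slide-column us xs _ ⟩
  _ ∎
  where
  open ≡-Reasoning
  left = map just us ʳ++ just m ∷ xs
  right = map just ys ʳ++ nothing ∷ zs
  go : ∀ ys → length us ≡ length ys → maybe′ (_< m) ⊤ (head ys) →
    slide (length ys) 1 (attach left (attach (map just ys ʳ++ nothing ∷ zs) []))
      ≡ slide (length ys) 0 (attach (modifyAt (length ys) (const nothing) left)
          (attach (modifyAt (length ys) (const (just m)) (map just ys ʳ++ nothing ∷ zs)) []))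
  go [] len lt =
    slide-left-top left (nothing ∷ zs)
      (head-drop-ʳ++ (map just us) 0 _ (trans (length-map just us) len))
  go (y ∷ ys) len lt = slide-left-one (length ys) left _
    (head-drop-ʳ++ (map just us) (suc (length ys)) _ (trans (length-map just us) len))
    (head-drop-ʳ++ (map just ys) (length ys) _ (length-map just ys))
    lt

-- Promotion column by column

isEntry? : ∀ T n → Decidable {A = ℕ × ℕ} (λ (c , r) → entry T r c ≡ just n)
isEntry? T n (c , r) = ≡-dec _≟_ (entry T r c) (just n)

columnDots : ℕ → Tableau → ℕ → List (ℕ × ℕ)
columnDots n T c = filter (isEntry? T n) (map (c ,_) (upTo (length T)))

slideAt : Dotted → ℕ × ℕ → Dotted
slideAt g (c , r) = slide r c g

slideColumn : ℕ → Tableau → Dotted → ℕ → Dotted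
slideColumn n T g c = foldl slideAt g (columnDots n T c)

foldl-columns : ∀ n T g cs →
  foldl slideAt g (filter (isEntry? T n) (cartesianProduct cs (upTo (length T))))
    ≡ foldl (slideColumn n T) g cs
foldl-columns n T g []       = refl
foldl-columns n T g (c ∷ cs) = begin
  foldl slideAt g (filter (isEntry? T n) (map (c ,_) (upTo (length T)) ++ rest))
    ≡⟨ cong (foldl slideAt g) (filter-++ (isEntry? T n) (map (c ,_) (upTo (length T))) rest) ⟩
  foldl slideAt g (columnDots n T c ++ filter (isEntry? T n) rest)
    ≡⟨ foldl-++ slideAt g (columnDots n T c) _ ⟩
  foldl slideAt (slideColumn n T g c) (filter (isEntry? T n) rest)
    ≡⟨ foldl-columns n T (slideColumn n T g c) cs ⟩
  foldl (slideColumn n T) (slideColumn n T g c) cs ∎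
  where
  open ≡-Reasoning
  rest = cartesianProduct cs (upTo (length T))

foldl-id : ∀ {A B : Set} (G : A → B → A) g f K →
  (∀ j → j < K → ∀ g → G g (f j) ≡ g) → foldl G g (applyUpTo f K) ≡ g
foldl-id G g f zero    fixed = refl
foldl-id G g f (suc K) fixed =
  trans (cong (λ g → foldl G g (applyUpTo (f ∘ suc) K)) (fixed 0 z<s g))
        (foldl-id G g (f ∘ suc) K (λ j j<K → fixed (suc j) (s<s j<K)))

-- Lets the number of columns scanned by `dots`, a maximum over all row lengths, be replaced by any
-- bound beyond which no `n` occurs.
foldl-change-bound : ∀ {A B : Set} (G : A → B → A) g f W K →
  (∀ j → W ≤ j → ∀ g → G g (f j) ≡ g) → (∀ j → K ≤ j → ∀ g → G g (f j) ≡ g) →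
  foldl G g (applyUpTo f W) ≡ foldl G g (applyUpTo f K)
foldl-change-bound G g f zero    K       w k = sym (foldl-id G g f K (λ j _ → w j z≤n))
foldl-change-bound G g f (suc W) zero    w k = foldl-id G g f (suc W) (λ j _ → k j z≤n)
foldl-change-bound G g f (suc W) (suc K) w k =
  foldl-change-bound G (G g (f 0)) (f ∘ suc) W K
    (λ j → w (suc j) ∘ s≤s) (λ j → k (suc j) ∘ s≤s)

foldl-applyUpTo-+ : ∀ {A B : Set} (G : A → B → A) g f m k →
  foldl G g (applyUpTo f (m + k)) ≡ foldl G (foldl G g (applyUpTo f m)) (applyUpTo (f ∘ (m +_)) k)
foldl-applyUpTo-+ G g f zero    k = refl
foldl-applyUpTo-+ G g f (suc m) k = foldl-applyUpTo-+ G (G g (f 0)) (f ∘ suc) m k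

slideColumn-none : ∀ n T c → (∀ r → entry T r c ≢ just n) → ∀ g → slideColumn n T g c ≡ g
slideColumn-none n T c none g = cong (foldl slideAt g)
  (filter-none (isEntry? T n) (All.map⁺ (All.applyUpTo⁺₂ id (length T) none)))

filter-single : ∀ {B : Set} {P : B → Set} (P? : Decidable P) (f : ℕ → B) L k → k < L →
  P (f k) → (∀ j → P (f j) → j ≡ k) → filter P? (applyUpTo f L) ≡ [ f k ]
filter-single P? f (suc L) zero    k<L p unique =
  trans (filter-accept P? p)
    (cong (f 0 ∷_) (filter-none P?
      (All.applyUpTo⁺₂ (f ∘ suc) L (λ j q → 1+n≢0 (unique (suc j) q)))))
filter-single P? f (suc L) (suc k) k<L p unique =
  trans (filter-reject P? (λ q → 0≢1+n (unique 0 q)))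
    (filter-single P? (f ∘ suc) L k (s≤s⁻¹ k<L) p (λ j q → suc-injective (unique (suc j) q)))

entry-just⇒< : ∀ {A : Set} (T : List (List A)) r c {x} → entry T r c ≡ just x → r < length T
entry-just⇒< []      zero    c ()
entry-just⇒< []      (suc r) c ()
entry-just⇒< (_ ∷ T) zero    c eq = z<s
entry-just⇒< (_ ∷ T) (suc r) c eq = s<s (entry-just⇒< T r c eq)

slideColumn-single : ∀ n T c r → entry T r c ≡ just n →
  (∀ r′ → entry T r′ c ≡ just n → r′ ≡ r) → ∀ g → slideColumn n T g c ≡ slide r c g
slideColumn-single n T c r eq unique g = cong (foldl slideAt g)
  (trans (cong (filter (isEntry? T n)) (map-upTo (c ,_) (length T)))
    (filter-single (isEntry? T n) (c ,_) (length T) r (entry-just⇒< T r c eq) eq unique))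

width : Tableau → ℕ
width T = foldr _⊔_ 0 (map length T)

head-drop-≥ : ∀ {A : Set} (xs : List A) k → length xs ≤ k → head (drop k xs) ≡ nothing
head-drop-≥ []       zero    _  = refl
head-drop-≥ []       (suc k) _  = refl
head-drop-≥ (x ∷ xs) (suc k) le = head-drop-≥ xs k (s≤s⁻¹ le)

entry-≥-width : ∀ T r c → width T ≤ c → entry T r c ≡ nothing
entry-≥-width []        r       c le = entry-[] r c
entry-≥-width (row ∷ T) zero    c le = head-drop-≥ row c (≤-trans (m≤m⊔n (length row) (width T)) le)
entry-≥-width (row ∷ T) (suc r) c le =
  entry-≥-width T r c (≤-trans (m≤n⊔m (length row) (width T)) le)

slideAll : ℕ → Tableau → Dotted
slideAll n T = foldl slideAt (dotted n T) (dots n T)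

just≢nothing : ∀ {x : ℕ} {m} → m ≡ nothing → m ≢ just x
just≢nothing refl ()

slideAll-columns : ∀ n T K → (∀ r c → K ≤ c → entry T r c ≢ just n) →
  slideAll n T ≡ foldl (slideColumn n T) (dotted n T) (upTo K)
slideAll-columns n T K none = trans (foldl-columns n T (dotted n T) (upTo (width T)))
  (foldl-change-bound (slideColumn n T) (dotted n T) id (width T) K
    (λ c W≤c → slideColumn-none n T c (λ r → just≢nothing (entry-≥-width T r c W≤c)))
    (λ c K≤c → slideColumn-none n T c (λ r → none r c K≤c)))

head-drop-∉ : ∀ {n} xs k → All (_< n) xs → head (drop k xs) ≢ just n
head-drop-∉ []       zero    []       ()
head-drop-∉ []       (suc k) []       ()
head-drop-∉ (x ∷ xs) zero    (p ∷ ps) refl = <-irrefl refl p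
head-drop-∉ (x ∷ xs) (suc k) (p ∷ ps) eq   = head-drop-∉ xs k ps eq

head-drop-last : ∀ {n : ℕ} xs → head (drop (length xs) (xs ∷ʳ n)) ≡ just n
head-drop-last []       = refl
head-drop-last (x ∷ xs) = head-drop-last xs

head-drop-last-unique : ∀ {n} xs k → All (_< n) xs → head (drop k (xs ∷ʳ n)) ≡ just n →
  k ≡ length xs
head-drop-last-unique []       zero          []       eq   = refl
head-drop-last-unique []       (suc zero)    []       ()
head-drop-last-unique []       (suc (suc k)) []       ()
head-drop-last-unique (x ∷ xs) zero          (p ∷ ps) refl = ⊥-elim (<-irrefl refl p)
head-drop-last-unique (x ∷ xs) (suc k)       (p ∷ ps) eq   =
  cong suc (head-drop-last-unique xs k ps eq)

dot : ℕ → ℕ → Maybe ℕ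
dot n x = if x ≡ᵇ n then nothing else just x

map-dot-< : ∀ {n xs} → All (_< n) xs → map (dot n) xs ≡ map just xs
map-dot-< []                      = refl
map-dot-< {n} {x ∷ xs} (p ∷ ps)
  rewrite ≢⇒≡ᵇ x n (<⇒≢ p) = cong (just x ∷_) (map-dot-< ps)

dot-self : ∀ n → dot n n ≡ nothing
dot-self n rewrite ≡ᵇ-refl n = refl

map-fill : ∀ xs → map (maybe′ suc 1) (map just xs) ≡ map suc xs
map-fill []       = refl
map-fill (x ∷ xs) = cong (suc x ∷_) (map-fill xs)

-- Words given by multiplicities

module _ {S : Set} where

  expand : (S → ℕ) → ℕ → List S → List ℕ
  expand f k []      = []
  expand f k (x ∷ σ) = replicate (f x) k ++ expand f (suc k) σ

  expand-++ : ∀ f k σ τ → expand f k (σ ++ τ) ≡ expand f k σ ++ expand f (k + length σ) τ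
  expand-++ f k []      τ rewrite +-identityʳ k = refl
  expand-++ f k (x ∷ σ) τ rewrite +-suc k (length σ) =
    trans (cong (replicate (f x) k ++_) (expand-++ f (suc k) σ τ))
          (sym (++-assoc (replicate (f x) k) _ _))

  expand-∷ʳ : ∀ f k σ x → expand f k (σ ∷ʳ x) ≡ expand f k σ ++ replicate (f x) (k + length σ)
  expand-∷ʳ f k σ x = trans (expand-++ f k σ [ x ]) (cong (expand f k σ ++_) (++-identityʳ _))

  map-suc-replicate : ∀ m k → map suc (replicate m k) ≡ replicate m (suc k)
  map-suc-replicate zero    k = refl
  map-suc-replicate (suc m) k = cong (suc k ∷_) (map-suc-replicate m k)

  map-suc-expand : ∀ f k σ → map suc (expand f k σ) ≡ expand f (suc k) σ
  map-suc-expand f k []      = refl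
  map-suc-expand f k (x ∷ σ) = trans (map-++ suc (replicate (f x) k) _)
    (cong₂ _++_ (map-suc-replicate (f x) k) (map-suc-expand f (suc k) σ))

  expand-≥ : ∀ f k σ → All (k ≤_) (expand f k σ)
  expand-≥ f k []      = []
  expand-≥ f k (x ∷ σ) =
    All.++⁺ (All.replicate⁺ (f x) ≤-refl) (All.map (≤-trans (n≤1+n k)) (expand-≥ f (suc k) σ))

  expand-< : ∀ f k σ → All (_< k + length σ) (expand f k σ)
  expand-< f k []      = []
  expand-< f k (x ∷ σ) rewrite +-suc k (length σ) =
    All.++⁺ (All.replicate⁺ (f x) (s≤s (m≤m+n k (length σ)))) (expand-< f (suc k) σ)

-- Traces of sorted words

trace-++ : ∀ i u v → trace i (u ++ v) ≡ trace i u ++ trace i v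
trace-++ i = concatMap-++ (traceLetter i)

trace-other : ∀ {i w} → All (λ x → x ≢ i × x ≢ suc i) w → trace i w ≡ []
trace-other []             = refl
trace-other ((p , q) ∷ ps) rewrite traceLetter-other p q = trace-other ps

below-other : ∀ {i x} → x < i → x ≢ i × x ≢ suc i
below-other x<i = <⇒≢ x<i , <⇒≢ (<-trans x<i (n<1+n _))

above-other : ∀ {i x} → suc (suc i) ≤ x → x ≢ i × x ≢ suc i
above-other i+2≤x = (λ x≡i → <⇒≢ (<-trans (n<1+n _) i+2≤x) (sym x≡i)) , λ x≡1+i →
  <⇒≢ i+2≤x (sym x≡1+i)

trace-replicate-low : ∀ i m → trace i (replicate m i) ≡ replicate m 0
trace-replicate-low i zero    = refl
trace-replicate-low i (suc m) rewrite traceLetter-low i = cong (0 ∷_) (trace-replicate-low i m)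

trace-replicate-high : ∀ i m → trace i (replicate m (suc i)) ≡ replicate m 1
trace-replicate-high i zero    = refl
trace-replicate-high i (suc m) rewrite traceLetter-high i = cong (1 ∷_) (trace-replicate-high i m)

agree-replicates : ∀ i a b c d → a + b ≡ c + d →
  Pointwise (Agree i) (replicate a i ++ replicate b (suc i)) (replicate c i ++ replicate d (suc i))
agree-replicates i zero    zero    zero    zero    eq = []
agree-replicates i zero    (suc b) zero    (suc d) eq =
  agree-refl ∷ agree-replicates i 0 b 0 d (suc-injective eq)
agree-replicates i zero    (suc b) (suc c) d       eq =
  inj₂ (inj₂ refl , inj₁ refl) ∷ agree-replicates i 0 b c d (suc-injective eq)
agree-replicates i (suc a) b       zero    (suc d) eq =
  inj₂ (inj₁ refl , inj₂ refl) ∷ agree-replicates i a b 0 d (suc-injective eq)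
agree-replicates i (suc a) b       (suc c) d       eq =
  agree-refl ∷ agree-replicates i a b c d (suc-injective eq)

module _ {S : Set} (f : S → ℕ) (α : List S) (x y : S) (β : List S) where

  private i = suc (length α)

  expand-split : expand f 1 (α ++ x ∷ y ∷ β)
    ≡ expand f 1 α ++ (replicate (f x) i ++ replicate (f y) (suc i)) ++ expand f (2 + i) β
  expand-split = trans (expand-++ f 1 α (x ∷ y ∷ β))
    (cong (expand f 1 α ++_) (sym (++-assoc (replicate (f x) i) (replicate (f y) (suc i)) _)))

  -- The letters of `α` are below `i` and those of `β` above `suc i`, so only the two middle blocks
  -- leave a trace.
  trace-expand : trace i (expand f 1 (α ++ x ∷ y ∷ β)) ≡ replicate (f x) 0 ++ replicate (f y) 1
  trace-expand rewrite expand-split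
    | trace-++ i (expand f 1 α) ((replicate (f x) i ++ replicate (f y) (suc i)) ++ expand f
      (2 + i) β)
    | trace-other {i} (All.map below-other (expand-< f 1 α))
    | trace-++ i (replicate (f x) i ++ replicate (f y) (suc i)) (expand f (2 + i) β)
    | trace-other {i} (All.map above-other (expand-≥ f (2 + i) β))
    | ++-identityʳ (trace i (replicate (f x) i ++ replicate (f y) (suc i)))
    | trace-++ i (replicate (f x) i) (replicate (f y) (suc i))
    | trace-replicate-low i (f x) | trace-replicate-high i (f y) = refl

agree-expand : ∀ {S : Set} (f : S → ℕ) α x y x′ y′ β → f x + f y ≡ f x′ + f y′ →
  Pointwise (Agree (suc (length α))) (expand f 1 (α ++ x ∷ y ∷ β)) (expand f 1 (α ++ x′ ∷ y′ ∷ β))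
agree-expand f α x y x′ y′ β eq =
  subst₂ (Pointwise (Agree _)) (sym (expand-split f α x y β)) (sym (expand-split f α x′ y′ β))
    (Pointwise.++⁺ (Pointwise.refl agree-refl {expand f 1 α})
      (Pointwise.++⁺ (agree-replicates (suc (length α)) (f x) (f y) (f x′) (f y′) eq)
        (Pointwise.refl agree-refl {expand f (3 + length α) β})))

pointwise-attach : ∀ {A B : Set} {R : A → B → Set} {xs xs′ rs rs′} →
  Pointwise R xs xs′ → Pointwise (Pointwise R) rs rs′ →
  Pointwise (Pointwise R) (attach xs rs) (attach xs′ rs′)
pointwise-attach []       qs       = []
pointwise-attach (p ∷ ps) []       = (p ∷ []) ∷ pointwise-attach ps []
pointwise-attach (p ∷ ps) (q ∷ qs) = (p ∷ q) ∷ pointwise-attach ps qs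

-- Commutation for tableaux with an abstract code

split-at : ∀ i (c : List ℕ) → suc (suc i) ≤ length c →
  ∃₂ λ a b → ∃₂ λ x y → c ≡ a ++ x ∷ y ∷ b × length a ≡ i
split-at zero    (x ∷ y ∷ c) _  = [] , c , x , y , refl , refl
split-at zero    (x ∷ [])    (s≤s ())
split-at (suc i) (z ∷ c)     le with split-at i c (s≤s⁻¹ le)
... | a , b , x , y , refl , refl = z ∷ a , b , x , y , refl , refl

-- Code c w T: the tableau T has content c, and w is a further datum on which
-- reflections act trivially, whereas promotion, which rotates the content,
-- changes it by ψ z, where z is the multiplicity of the largest letter.
module Commutation {W : Set} (n : ℕ) (Code : List ℕ → W → Tableau → Set) (ψ : ℕ → W → W)
  (ψ-comm : ∀ x y w → ψ x (ψ y w) ≡ ψ y (ψ x w))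
  (code-length : ∀ {c w T} → Code c w T → length c ≡ n)
  (code-unique : ∀ {c w T T′} → Code c w T → Code c w T′ → T ≡ T′)
  (code-s : ∀ a x y b {w T} → Code (a ++ x ∷ y ∷ b) w T →
            Code (a ++ y ∷ x ∷ b) w (s (suc (length a)) T))
  (code-pr : ∀ c z {w T} → Code (c ∷ʳ z) w T → Code (z ∷ c) (ψ z w) (pr n T))
  where

  Coded : Tableau → Set
  Coded T = ∃₂ λ c w → Code c w T

  -- The head of `b` is the last multiplicity at the moment. Each promotion moves it to the front of
  -- `a`, until `b` is used up.
  code-iterate : ∀ a b {w T} → Code (a ++ reverse b) w T →
    Code (reverse b ++ a) (foldl (flip ψ) w b) (iterate (pr n) T (length b))
  code-iterate a []      d = subst (λ c → Code c _ _) (++-identityʳ a) d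
  code-iterate a (z ∷ b) {w} {T} d =
    subst (λ c → Code c (foldl (flip ψ) (ψ z w) b) (iterate (pr n) (pr n T) (length b)))
      (trans (sym (++-assoc (reverse b) [ z ] a)) (cong (_++ a) (sym (unfold-reverse z b))))
      (code-iterate (z ∷ a) b (code-pr (a ++ reverse b) z
        (subst (λ c → Code c w T)
          (trans (cong (a ++_) (unfold-reverse z b)) (sym (++-assoc a (reverse b) [ z ]))) d)))

  -- The number of promotions equals the length of `c`, so the content makes one full turn. The left
  -- fold over the reversed content becomes a right fold over `c`.
  code-prⁿ : ∀ {c w T} → Code c w T → Code c (foldr ψ w c) (prⁿ n T)
  code-prⁿ {c} {w} {T} d = subst₂ (λ c′ w′ → Code c′ w′ (prⁿ n T))
    (trans (++-identityʳ _) (reverse-involutive c))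
    (reverse-foldl (flip ψ) w c)
    (subst (λ k → Code (reverse (reverse c) ++ []) (foldl (flip ψ) w (reverse c))
      (iterate (pr n) T k))
      (trans (length-reverse c) (code-length d))
      (code-iterate [] (reverse c) (subst (λ c → Code c w T) (sym (reverse-involutive c)) d)))

  -- Both sides have the exchanged content, and the same word because the two applications of `ψ`
  -- commute; a code determines its tableau. The code of `s i T` is returned as well, so that
  -- reflections can be composed in `cox`.
  s-prⁿ : ∀ i {T} → 1 ≤ i → i < n → Coded T → Coded (s i T) × s i (prⁿ n T) ≡ prⁿ n (s i T)
  s-prⁿ (suc i) {T} 1≤i i<n (c , w , d) with split-at i c
    (subst (suc (suc i) ≤_) (sym (code-length d)) i<n)
  ... | a , b , x , y , refl , refl =
    (_ , w , code-s a x y b d) ,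
    code-unique
      (subst (λ w′ → Code (a ++ y ∷ x ∷ b) w′ (s (suc i) (prⁿ n T))) swap
        (code-s a x y b (code-prⁿ d)))
      (code-prⁿ (code-s a x y b d))
    where
    swap : foldr ψ w (a ++ x ∷ y ∷ b) ≡ foldr ψ w (a ++ y ∷ x ∷ b)
    swap = trans (foldr-++ ψ w a _)
      (trans (cong (λ v → foldr ψ v a) (ψ-comm x y _)) (sym (foldr-++ ψ w a _)))

  word-prⁿ : ∀ is {T} → All (λ i → 1 ≤ i × i < n) is → Coded T →
    Coded (foldr s T is) × foldr s (prⁿ n T) is ≡ prⁿ n (foldr s T is)
  word-prⁿ []       []               d = d , refl
  word-prⁿ (i ∷ is) ((p , q) ∷ pqs) d with word-prⁿ is pqs d
  ... | d′ , eq with s-prⁿ i p q d′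
  ...   | d″ , eq′ = d″ , trans (cong (s i) eq) eq′

  cox-prⁿ : ∀ {T} → Coded T → cox n (prⁿ n T) ≡ prⁿ n (cox n T)
  cox-prⁿ d = proj₂ (word-prⁿ _ (All.map⁺ (All.applyUpTo⁺₁ id (n ∸ 1)
    (λ j<n-1 → s≤s z≤n , j<n∸1⇒1+j<n j<n-1))) d)
    where
    j<n∸1⇒1+j<n : ∀ {j n} → j < n ∸ 1 → suc j < n
    j<n∸1⇒1+j<n {n = suc n} lt = s≤s lt

-- Slides up the first column and along the first row

map-reverse-ʳ++ : ∀ {A B : Set} (f : A → B) xs ws → map f (reverse xs) ʳ++ ws ≡ map f xs ++ ws
map-reverse-ʳ++ f xs ws = trans (ʳ++-defn (map f (reverse xs)))
  (cong (_++ ws) (trans (sym (reverse-map f (reverse xs))) (cong (map f) (reverse-involutive xs))))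

slide-column-++ : ∀ X xs rs →
  slide (length X) 0 (attach (map just X ++ nothing ∷ xs) rs)
    ≡ attach (nothing ∷ (map just X ++ xs)) rs
slide-column-++ X xs rs = begin
  slide (length X) 0 (attach (map just X ++ nothing ∷ xs) rs)
    ≡⟨ cong₂ (λ k ys → slide k 0 (attach ys rs)) (sym (length-reverse X))
      (sym (map-reverse-ʳ++ just X _)) ⟩
  slide (length (reverse X)) 0 (attach (map just (reverse X) ʳ++ nothing ∷ xs) rs)
    ≡⟨ slide-column (reverse X) xs rs ⟩
  attach (nothing ∷ (map just (reverse X) ʳ++ xs)) rs
    ≡⟨ cong (λ ys → attach (nothing ∷ ys) rs) (map-reverse-ʳ++ just X xs) ⟩
  attach (nothing ∷ (map just X ++ xs)) rs ∎
  where open ≡-Reasoning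

replicate-++-∷ : ∀ {A : Set} j (x : A) ws → replicate j x ++ x ∷ ws ≡ x ∷ replicate j x ++ ws
replicate-++-∷ zero    x ws = refl
replicate-++-∷ (suc j) x ws = cong (x ∷_) (replicate-++-∷ j x ws)

replicate-ʳ++ : ∀ {A : Set} j (x : A) ws → replicate j x ʳ++ ws ≡ replicate j x ++ ws
replicate-ʳ++ zero    x ws = refl
replicate-ʳ++ (suc j) x ws = trans (replicate-ʳ++ j x (x ∷ ws)) (replicate-++-∷ j x ws)

slide-row-++ : ∀ j A xs G →
  slide 0 (length A + j) ((replicate j nothing ++ map just A ++ nothing ∷ xs) ∷ G)
    ≡ (replicate (suc j) nothing ++ map just A ++ xs) ∷ G
slide-row-++ j A xs G = begin
  slide 0 (length A + j) ((replicate j nothing ++ map just A ++ nothing ∷ xs) ∷ G)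
    ≡⟨ cong₂ (λ k row → slide 0 (k + j) (row ∷ G)) (sym (length-reverse A)) (sym before) ⟩
  slide 0 (length (reverse A) + j)
    (((map just (reverse A) ++ replicate j nothing) ʳ++ nothing ∷ xs) ∷ G)
    ≡⟨ slide-row j (reverse A) xs G ⟩
  (replicate j nothing ʳ++ nothing ∷ (map just (reverse A) ʳ++ xs)) ∷ G
    ≡⟨ cong (_∷ G) after ⟩
  (replicate (suc j) nothing ++ map just A ++ xs) ∷ G ∎
  where
  open ≡-Reasoning
  before : (map just (reverse A) ++ replicate j nothing) ʳ++ nothing ∷ xs
    ≡ replicate j nothing ++ map just A ++ nothing ∷ xs
  before = trans (++-ʳ++ (map just (reverse A)))
    (trans (replicate-ʳ++ j nothing _)
      (cong (replicate j nothing ++_) (map-reverse-ʳ++ just A _)))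
  after : replicate j nothing ʳ++ nothing ∷ (map just (reverse A) ʳ++ xs)
    ≡ replicate (suc j) nothing ++ map just A ++ xs
  after = trans (replicate-ʳ++ (suc j) nothing _)
    (cong (replicate (suc j) nothing ++_) (map-reverse-ʳ++ just A xs))

foldl-slide-row : ∀ a d A G f (H : Dotted → ℕ → Dotted) →
  (∀ j → j < a → ∀ g → H g (f j) ≡ slide 0 (length A + (d + j)) g) →
  foldl H ((replicate d nothing ++ map just A ++ replicate a nothing) ∷ G) (applyUpTo f a)
    ≡ (replicate (d + a) nothing ++ map just A) ∷ G
foldl-slide-row zero    d A G f H eq
  rewrite +-identityʳ d | ++-identityʳ (map {B = Maybe ℕ} just A) = refl
foldl-slide-row (suc a) d A G f H eq
  rewrite eq 0 z<s ((replicate d nothing ++ map just A ++ nothing ∷ replicate a nothing) ∷ G)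
        | +-identityʳ d
        | slide-row-++ d A (replicate a nothing) G
        | +-suc d a
  = foldl-slide-row a (suc d) A G (f ∘ suc) H
      (λ j j<a g → trans (eq (suc j) (s<s j<a) g)
        (cong (λ k → slide 0 (length A + k) g) (+-suc d j)))

-- Promotion of hooks

hook : List ℕ → List ℕ → Tableau
hook R L = R ∷ attach L []

entry-leg-suc : ∀ (L : List ℕ) r c → entry (attach L []) r (suc c) ≡ nothing
entry-leg-suc L r c = trans (entry-attach-suc L [] r c z≤n) (entry-[] r c)

slideAll-hook : ∀ n x A L → let T = hook (x ∷ A) L in
  slideAll n T ≡ foldl (slideColumn n T) (dotted n T) (upTo (length (x ∷ A)))
slideAll-hook n x A L = slideAll-columns n (hook (x ∷ A) L) (length (x ∷ A)) none
  where
  none : ∀ r c → length (x ∷ A) ≤ c → entry (hook (x ∷ A) L) r c ≢ just n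
  none zero    c       le = just≢nothing (head-drop-≥ (x ∷ A) c le)
  none (suc r) (suc c) le = just≢nothing (entry-leg-suc L r c)

-- What is needed for the leg to contribute no `n` to column `c`: a condition in column 0, nothing
-- elsewhere, where the leg has no cells.
LowBelow : ℕ → List ℕ → ℕ → Set
LowBelow n L zero    = All (_< n) L
LowBelow n L (suc c) = ⊤

lowBelow-entry : ∀ n L c r → LowBelow n L c → entry (attach L []) r c ≢ just n
lowBelow-entry n L zero    r p eq = head-drop-∉ L r p (trans (sym (entry-attach-zero L [] r)) eq)
lowBelow-entry n L (suc c) r p = just≢nothing (entry-leg-suc L r c)

head-drop-<-length : ∀ {n} A B j → j < length A → All (_< n) A → head (drop j (A ++ B)) ≢ just n
head-drop-<-length (x ∷ A) B zero    lt (p ∷ ps) refl = <-irrefl refl p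
head-drop-<-length (x ∷ A) B (suc j) lt (p ∷ ps) eq   = head-drop-<-length A B j (s≤s⁻¹ lt) ps eq

head-drop-replicate : ∀ {n : ℕ} A a j → j < a →
  head (drop (length A + j) (A ++ replicate a n)) ≡ just n
head-drop-replicate []      (suc a) zero    lt = refl
head-drop-replicate []      (suc a) (suc j) lt = head-drop-replicate [] a j (s≤s⁻¹ lt)
head-drop-replicate (x ∷ A) a       j       lt = head-drop-replicate A a j lt

slideColumn-hook-none : ∀ n A B L c → c < length A → All (_< n) A → LowBelow n L c →
  ∀ g → slideColumn n (hook (A ++ B) L) g c ≡ g
slideColumn-hook-none n A B L c c< pA pL = slideColumn-none n (hook (A ++ B) L) c none
  where
  none : ∀ r → entry (hook (A ++ B) L) r c ≢ just n
  none zero    = head-drop-<-length A B c c< pA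
  none (suc r) = lowBelow-entry n L c r pL

slideColumn-hook-row : ∀ n A a L j → j < a → LowBelow n L (length A + j) →
  ∀ g → slideColumn n (hook (A ++ replicate a n) L) g (length A + j) ≡ slide 0 (length A + j) g
slideColumn-hook-row n A a L j j<a pL =
  slideColumn-single n (hook (A ++ replicate a n) L) (length A + j) 0
    (head-drop-replicate A a j j<a) unique
  where
  unique : ∀ r → entry (hook (A ++ replicate a n) L) r (length A + j) ≡ just n → r ≡ 0
  unique zero    eq = refl
  unique (suc r) eq = ⊥-elim (lowBelow-entry n L (length A + j) r pL eq)

map-dot-row : ∀ n A a → All (_< n) A →
  map (dot n) (A ++ replicate a n) ≡ map just A ++ replicate a nothing
map-dot-row n A a p = trans (map-++ (dot n) A (replicate a n))
  (cong₂ _++_ (map-dot-< p) (trans (map-replicate (dot n) a n) (cong (replicate a) (dot-self n))))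

map-fill-row : ∀ k A → map (maybe′ suc 1) (replicate k nothing ++ map just A)
  ≡ replicate k 1 ++ map suc A
map-fill-row k A = trans (map-++ _ (replicate k nothing) (map just A))
  (cong₂ _++_ (map-replicate _ k nothing) (map-fill A))

lowBelow : ∀ n L c → All (_< n) L → LowBelow n L c
lowBelow n L zero    p = p
lowBelow n L (suc c) p = tt

pr-hook-row : ∀ n A L a → 0 < length (A ++ replicate a n) → All (_< n) A → All (_< n) L →
  pr n (hook (A ++ replicate a n) L) ≡ hook (replicate a 1 ++ map suc A) (map suc L)
pr-hook-row n A L a nonempty pA pL = begin
  map (map (maybe′ suc 1)) (slideAll n T₀)
    ≡⟨ cong (map (map (maybe′ suc 1))) slides ⟩
  map (map (maybe′ suc 1)) ((replicate a nothing ++ map just A) ∷ attach (map just L) [])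
    ≡⟨ cong₂ _∷_ (map-fill-row a A)
        (trans (map-attach _ (map just L) []) (cong (λ l → attach l []) (map-fill L))) ⟩
  hook (replicate a 1 ++ map suc A) (map suc L) ∎
  where
  open ≡-Reasoning
  T₀ = hook (A ++ replicate a n) L
  upto : ∀ R → 0 < length R → slideAll n (hook R L)
    ≡ foldl (slideColumn n (hook R L)) (dotted n (hook R L)) (upTo (length R))
  upto (x ∷ R) _ = slideAll-hook n x R L
  slides : slideAll n T₀ ≡ (replicate a nothing ++ map just A) ∷ attach (map just L) []
  slides = begin
    slideAll n T₀
      ≡⟨ upto (A ++ replicate a n) nonempty ⟩
    foldl (slideColumn n T₀) (dotted n T₀) (upTo (length (A ++ replicate a n)))
      ≡⟨ cong₂ (λ g k → foldl (slideColumn n T₀) g (upTo k))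
           (cong₂ _∷_ (map-dot-row n A a pA)
             (trans (map-attach (dot n) L []) (cong (λ l → attach l []) (map-dot-< pL))))
           (trans (length-++ A) (cong (length A +_) (length-replicate a))) ⟩
    foldl (slideColumn n T₀) g₀ (upTo (length A + a))
      ≡⟨ foldl-applyUpTo-+ (slideColumn n T₀) g₀ id (length A) a ⟩
    foldl (slideColumn n T₀) (foldl (slideColumn n T₀) g₀ (upTo (length A)))
      (applyUpTo (length A +_) a)
      ≡⟨ cong (λ g → foldl (slideColumn n T₀) g (applyUpTo (length A +_) a))
           (foldl-id (slideColumn n T₀) g₀ id (length A)
             (λ j j< → slideColumn-hook-none n A (replicate a n) L j j< pA (lowBelow n L j pL))) ⟩
    foldl (slideColumn n T₀) g₀ (applyUpTo (length A +_) a)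
      ≡⟨ foldl-slide-row a 0 A (attach (map just L) []) (length A +_) (slideColumn n T₀)
           (λ j j<a → slideColumn-hook-row n A a L j j<a (lowBelow n L _ pL)) ⟩
    (replicate a nothing ++ map just A) ∷ attach (map just L) [] ∎
    where g₀ = (map just A ++ replicate a nothing) ∷ attach (map just L) []

-- The dot from the foot of the leg rises to the corner and pushes every entry of the first column
-- down by one cell, so the corner entry `x` joins the leg. The dots of the row then come to rest
-- next to the corner.
pr-hook-leg : ∀ n x A L a → All (_< n) (x ∷ A) → All (_< n) L →
  pr n (hook (x ∷ A ++ replicate a n) (L ∷ʳ n))
    ≡ hook (replicate (suc a) 1 ++ map suc A) (map suc (x ∷ L))
pr-hook-leg n x A L a (px ∷ pA) pL = begin
  map (map (maybe′ suc 1)) (slideAll n T₀)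
    ≡⟨ cong (map (map (maybe′ suc 1))) slides ⟩
  map (map (maybe′ suc 1)) ((replicate (suc a) nothing ++ map just A) ∷ attach
    (map just (x ∷ L)) [])
    ≡⟨ cong₂ _∷_ (map-fill-row (suc a) A)
        (trans (map-attach _ (map just (x ∷ L)) []) (cong (λ l → attach l []) (map-fill (x ∷ L)))) ⟩
  hook (replicate (suc a) 1 ++ map suc A) (map suc (x ∷ L)) ∎
  where
  open ≡-Reasoning
  T₀ = hook (x ∷ A ++ replicate a n) (L ∷ʳ n)
  H = slideColumn n T₀
  arm = map just A ++ replicate a nothing
  g₀ = attach (map just (x ∷ L) ++ [ nothing ]) [ arm ]
  g₁ = (nothing ∷ arm) ∷ attach (map just (x ∷ L)) []
  corner : ∀ g → H g 0 ≡ slide (length (x ∷ L)) 0 g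
  corner = slideColumn-single n T₀ 0 (length (x ∷ L))
    (trans (entry-attach-zero (L ∷ʳ n) [] (length L)) (head-drop-last L)) unique
    where
    unique : ∀ r → entry T₀ r 0 ≡ just n → r ≡ length (x ∷ L)
    unique zero    refl = ⊥-elim (<-irrefl refl px)
    unique (suc r) eq   = cong suc
      (head-drop-last-unique L r pL (trans (sym (entry-attach-zero (L ∷ʳ n) [] r)) eq))
  dots₀ : dotted n T₀ ≡ g₀
  dots₀ rewrite ≢⇒≡ᵇ x n (<⇒≢ px) = cong₂ _∷_ (cong (just x ∷_) (map-dot-row n A a pA))
    (trans (map-attach (dot n) (L ∷ʳ n) []) (cong (λ l → attach l []) (map-dot-row n L 1 pL)))
  slides : slideAll n T₀ ≡ (replicate (suc a) nothing ++ map just A) ∷ attach (map just (x ∷ L)) []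
  slides = begin
    slideAll n T₀
      ≡⟨ slideAll-hook n x (A ++ replicate a n) (L ∷ʳ n) ⟩
    foldl H (dotted n T₀) (upTo (suc (length (A ++ replicate a n))))
      ≡⟨ cong₂ (λ g k → foldl H g (upTo (suc k))) dots₀
           (trans (length-++ A) (cong (length A +_) (length-replicate a))) ⟩
    foldl H g₀ (upTo (suc (length A) + a))
      ≡⟨ foldl-applyUpTo-+ H (H g₀ 0) suc (length A) a ⟩
    foldl H (foldl H (H g₀ 0) (applyUpTo suc (length A))) (applyUpTo (λ j → suc (length A + j)) a)
      ≡⟨ cong (λ g → foldl H g (applyUpTo (λ j → suc (length A + j)) a))
           (foldl-id H (H g₀ 0) suc (length A)
             (λ j j< → slideColumn-hook-none n (x ∷ A) (replicate a n) (L ∷ʳ n) (suc j) (s<s j<)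
               (px ∷ pA) tt)) ⟩
    foldl H (H g₀ 0) (applyUpTo (λ j → suc (length A + j)) a)
      ≡⟨ cong (λ g → foldl H g (applyUpTo (λ j → suc (length A + j)) a))
           (trans (corner g₀) (trans (slide-column-++ (x ∷ L) [] [ arm ])
             (cong (λ l → attach (nothing ∷ l) [ arm ]) (++-identityʳ (map just (x ∷ L)))))) ⟩
    foldl H g₁ (applyUpTo (λ j → suc (length A + j)) a)
      -- The offset 1 is the dot that already occupies the corner.
      ≡⟨ foldl-slide-row a 1 A (attach (map just (x ∷ L)) []) (λ j → suc (length A + j)) H
           (λ j j<a g → trans (slideColumn-hook-row n (x ∷ A) a (L ∷ʳ n) j j<a tt g)
             (cong (λ k → slide 0 k g) (sym (+-suc (length A) j)))) ⟩
    (replicate (suc a) nothing ++ map just A) ∷ attach (map just (x ∷ L)) [] ∎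

map≡++ : ∀ {A B : Set} (f : A → B) xs us vs → map f xs ≡ us ++ vs →
  ∃₂ λ ys zs → xs ≡ ys ++ zs × map f ys ≡ us × map f zs ≡ vs
map≡++ f xs       []       vs eq = [] , xs , refl , refl , eq
map≡++ f (x ∷ xs) (u ∷ us) vs eq with map≡++ f xs us vs (∷-injectiveʳ eq)
... | ys , zs , refl , eq₁ , eq₂ = x ∷ ys , zs , refl , cong₂ _∷_ (∷-injectiveˡ eq) eq₁ , eq₂

-- A tableau with entries in 1, …, n is recorded by a list σ of n states, one
-- per letter; Core σ w says that w is the part of σ independent of the content.
record StateCode {S W : Set} (content : S → ℕ) (Core : List S → W → Set)
  (tableau : List S → Tableau)
  (n : ℕ) (c : List ℕ) (w : W) (T : Tableau) : Set where
  constructor code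
  field
    σ         : List S
    length-σ  : length σ ≡ n
    content-σ : map content σ ≡ c
    core-σ    : Core σ w
    tableau-σ : tableau σ ≡ T

-- Contents and legs of hooks

bit : Bool → ℕ
bit false = 0
bit true  = 1

HookState : Set
HookState = ℕ × Bool

row leg hookContent : HookState → ℕ
row (a , _) = a
leg (_ , b) = bit b
hookContent (a , b) = a + bit b

bits : List HookState → List Bool
bits []                  = []
bits ((zero , false) ∷ σ) = bits σ
bits ((zero , true) ∷ σ)  = true ∷ bits σ
bits ((suc a , b) ∷ σ)    = b ∷ bits σ

bits-++ : ∀ σ τ → bits (σ ++ τ) ≡ bits σ ++ bits τ
bits-++ []                   τ = refl
bits-++ ((zero , false) ∷ σ) τ = bits-++ σ τ
bits-++ ((zero , true) ∷ σ)  τ = cong (true ∷_) (bits-++ σ τ)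
bits-++ ((suc a , b) ∷ σ)    τ = cong (b ∷_) (bits-++ σ τ)

-- The content tells which letters own a bit, and the bit tells how the multiplicity is divided
-- between row and leg.
hookState-unique : ∀ σ τ → map hookContent σ ≡ map hookContent τ → bits σ ≡ bits τ → σ ≡ τ
hookState-unique [] [] c b = refl
hookState-unique ((zero , false) ∷ σ) ((zero , false) ∷ τ) c b =
  cong (_ ∷_) (hookState-unique σ τ (∷-injectiveʳ c) b)
hookState-unique ((zero , true) ∷ σ) ((zero , true) ∷ τ) c b =
  cong (_ ∷_) (hookState-unique σ τ (∷-injectiveʳ c) (∷-injectiveʳ b))
hookState-unique ((zero , true) ∷ σ) ((suc d , false) ∷ τ) c b with ∷-injectiveˡ b
... | ()
hookState-unique ((zero , true) ∷ σ) ((suc zero , true) ∷ τ) c b with ∷-injectiveˡ c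
... | ()
hookState-unique ((zero , true) ∷ σ) ((suc (suc d) , true) ∷ τ) c b with ∷-injectiveˡ c
... | ()
hookState-unique ((suc a , false) ∷ σ) ((zero , true) ∷ τ) c b with ∷-injectiveˡ b
... | ()
hookState-unique ((suc zero , true) ∷ σ) ((zero , true) ∷ τ) c b with ∷-injectiveˡ c
... | ()
hookState-unique ((suc (suc a) , true) ∷ σ) ((zero , true) ∷ τ) c b with ∷-injectiveˡ c
... | ()
hookState-unique ((suc a , b) ∷ σ) ((suc d , e) ∷ τ) c eq with ∷-injectiveˡ eq
... | refl with +-cancelʳ-≡ (bit b) (suc a) (suc d) (∷-injectiveˡ c)
...   | refl = cong (_ ∷_) (hookState-unique σ τ (∷-injectiveʳ c) (∷-injectiveʳ eq))

hookTableau : List HookState → Tableau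
hookTableau σ = hook (expand row 1 σ) (expand leg 1 σ)

-- The smallest letter that occurs is the corner entry and cannot recur in the leg, so the leading
-- bit is always `false`. Only the bits after it are rotated by promotion.
HookCore : List HookState → List Bool → Set
HookCore σ w = bits σ ≡ false ∷ w

HookCode : ℕ → List ℕ → List Bool → Tableau → Set
HookCode = StateCode hookContent HookCore hookTableau

hookCode-length : ∀ {n c w T} → HookCode n c w T → length c ≡ n
hookCode-length (code σ len refl _ _) = trans (length-map hookContent σ) len

hookCode-unique : ∀ {n c w T T′} → HookCode n c w T → HookCode n c w T′ → T ≡ T′
hookCode-unique (code σ _ cσ bσ refl) (code τ _ cτ bτ refl) =
  cong hookTableau (hookState-unique σ τ (trans cσ (sym cτ)) (trans bσ (sym bτ)))

-- Reflections of hooks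

closeFirst-ones : ∀ b → closeFirst 0 (map (_, true) (replicate b 1)) ≡ nothing
closeFirst-ones zero    = refl
closeFirst-ones (suc b) rewrite closeFirst-ones b = refl

match-zeros-ones : ∀ a b → match 0 (replicate a 0 ++ replicate b 1)
  ≡ map (_, true) (replicate a 0 ++ replicate b 1)
match-zeros-ones (suc a) b       = cong (_ ∷_) (match-zeros-ones a b)
match-zeros-ones zero    zero    = refl
match-zeros-ones zero    (suc b)
  rewrite match-zeros-ones zero b | closeFirst-ones b = refl

countUnmatched-zeros-ones : ∀ a b →
  countUnmatched 1 (map (_, true) (replicate a 0 ++ replicate b 1)) ≡ b
countUnmatched-zeros-ones (suc a) b       = countUnmatched-zeros-ones a b
countUnmatched-zeros-ones zero    zero    = refl
countUnmatched-zeros-ones zero    (suc b) = cong suc (countUnmatched-zeros-ones zero b)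

refill-unmatched : ∀ k m w → length w ≡ k + m →
  refill 0 k (map (_, true) w) ≡ replicate k 0 ++ replicate m 1
refill-unmatched zero    zero    []      eq = refl
refill-unmatched zero    (suc m) (x ∷ w) eq =
  cong (1 ∷_) (refill-unmatched zero m w (suc-injective eq))
refill-unmatched (suc k) m       (x ∷ w) eq =
  cong (0 ∷_) (refill-unmatched k m w (suc-injective eq))

-- No opening bracket 1 stands before a closing bracket 0, so every letter is unmatched.
reflectWord-zeros-ones : ∀ a b →
  reflectWord 0 (replicate a 0 ++ replicate b 1) ≡ replicate b 0 ++ replicate a 1
reflectWord-zeros-ones a b rewrite match-zeros-ones a b | countUnmatched-zeros-ones a b =
  refill-unmatched b a _ (trans (length-++ (replicate a 0))
    (trans (cong₂ _+_ (length-replicate a) (length-replicate b)) (+-comm a b)))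

-- The reading word runs up the leg before it runs along the row, hence the reversed first part.
hookTrace : HookState → HookState → List ℕ
hookTrace x y = reverse (replicate (leg x) 0 ++ replicate (leg y) 1) ++
  (replicate (row x) 0 ++ replicate (row y) 1)

record HookSwap (x y : HookState) : Set where
  constructor swap
  field
    x′ y′     : HookState
    content-x : hookContent x′ ≡ hookContent y
    content-y : hookContent y′ ≡ hookContent x
    bits-xy   : bits (x′ ∷ y′ ∷ []) ≡ bits (x ∷ y ∷ [])
    row-xy    : row x + row y ≡ row x′ + row y′
    leg-xy    : leg x + leg y ≡ leg x′ + leg y′
    trace-xy  : hookTrace x′ y′ ≡ reflectWord 0 (hookTrace x y)

-- At most one pair of brackets is matched: an i+1 in the leg with the first i read after it. If
-- only one of the two letters occurs, its whole state passes to the other letter. If both occur,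
-- each keeps its bit and only the multiplicities in the row change.
hookSwap : ∀ x y → HookSwap x y
hookSwap (zero , false) (zero , false) =
  swap (zero , false) (zero , false) refl refl refl refl refl refl
hookSwap (zero , false) (zero , true) =
  swap (zero , true) (zero , false) refl refl refl refl refl refl
hookSwap (zero , false) (suc a , false) = swap (suc a , false) (zero , false) refl refl refl
  (sym (+-identityʳ _)) refl (sym (reflectWord-zeros-ones 0 (suc a)))
hookSwap (zero , false) (suc a , true) = swap (suc a , true) (zero , false) refl refl refl
  (sym (+-identityʳ _)) refl (sym (reflectWord-zeros-ones 0 (suc (suc a))))
hookSwap (zero , true) (zero , false) =
  swap (zero , false) (zero , true) refl refl refl refl refl refl
hookSwap (suc a , false) (zero , false) = swap (zero , false) (suc a , false) refl refl refl
  (+-identityʳ _) refl (sym (reflectWord-zeros-ones (suc a) 0))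
hookSwap (suc a , true) (zero , false) = swap (zero , false) (suc a , true) refl refl refl
  (+-identityʳ _) refl (sym (reflectWord-zeros-ones (suc (suc a)) 0))
hookSwap (suc a , false) (suc d , false) = swap (suc d , false) (suc a , false) refl refl refl
  (+-comm (suc a) (suc d)) refl (sym (reflectWord-zeros-ones (suc a) (suc d)))
hookSwap (a , true) (d , true) = swap (d , true) (a , true) refl refl (bits-swap a d)
  (+-comm a d) refl (cong (λ w → 1 ∷ 0 ∷ w) (sym (reflectWord-zeros-ones a d)))
  where
  bits-swap : ∀ a d → bits ((d , true) ∷ (a , true) ∷ []) ≡ bits ((a , true) ∷ (d , true) ∷ [])
  bits-swap zero    zero    = refl
  bits-swap zero    (suc _) = refl
  bits-swap (suc _) zero    = refl
  bits-swap (suc _) (suc _) = refl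
hookSwap (a , true) (suc d , false) = swap (d , true) (suc a , false)
  (trans (+-comm d 1) (sym (+-identityʳ _))) (trans (+-identityʳ _) (+-comm 1 a)) (bits-swap a d)
  (trans (+-suc a d) (trans (cong suc (+-comm a d)) (sym (+-suc d a)))) refl
  (sym (reflectWord-zeros-ones (suc a) (suc d)))
  where
  bits-swap : ∀ a d → bits ((d , true) ∷ (suc a , false) ∷ [])
    ≡ bits ((a , true) ∷ (suc d , false) ∷ [])
  bits-swap zero    zero    = refl
  bits-swap zero    (suc _) = refl
  bits-swap (suc _) zero    = refl
  bits-swap (suc _) (suc _) = refl
hookSwap (suc a , false) (d , true) = swap (suc d , false) (a , true)
  (trans (+-identityʳ _) (+-comm 1 d)) (trans (+-comm a 1) (sym (+-identityʳ _))) (bits-swap a d)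
  (cong suc (+-comm a d)) refl
  (cong (λ w → 1 ∷ 0 ∷ w) (sym (reflectWord-zeros-ones a d)))
  where
  bits-swap : ∀ a d → bits ((suc d , false) ∷ (a , true) ∷ [])
    ≡ bits ((suc a , false) ∷ (d , true) ∷ [])
  bits-swap zero    zero    = refl
  bits-swap zero    (suc _) = refl
  bits-swap (suc _) zero    = refl
  bits-swap (suc _) (suc _) = refl

trace-reverse : ∀ i w → trace i (reverse w) ≡ reverse (trace i w)
trace-reverse i []      = refl
trace-reverse i (x ∷ w) = begin
  trace i (reverse (x ∷ w))                     ≡⟨ cong (trace i) (unfold-reverse x w) ⟩
  trace i (reverse w ++ [ x ])                  ≡⟨ trace-++ i (reverse w) [ x ] ⟩
  trace i (reverse w) ++ trace i [ x ]          ≡⟨ cong₂ _++_ (trace-reverse i w) (++-identityʳ _) ⟩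
  reverse (trace i w) ++ traceLetter i x        ≡⟨ cong (reverse (trace i w) ++_) single ⟩
  reverse (trace i w) ++ reverse (traceLetter i x) ≡⟨ reverse-++ (traceLetter i x) (trace i w) ⟨
  reverse (trace i (x ∷ w)) ∎
  where
  open ≡-Reasoning
  single : traceLetter i x ≡ reverse (traceLetter i x)
  single with x ≡ᵇ i | x ≡ᵇ suc i
  ... | true  | _     = refl
  ... | false | true  = refl
  ... | false | false = refl

concat-reverse-column : ∀ (L : List ℕ) → concat (reverse (attach L [])) ≡ reverse L
concat-reverse-column []      = refl
concat-reverse-column (x ∷ L) = begin
  concat (reverse ([ x ] ∷ attach L []))      ≡⟨ cong concat (unfold-reverse [ x ] (attach L [])) ⟩
  concat (reverse (attach L []) ++ [ [ x ] ]) ≡⟨ concat-++ (reverse (attach L [])) [ [ x ] ] ⟨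
  concat (reverse (attach L [])) ++ [ x ]     ≡⟨ cong (_++ [ x ]) (concat-reverse-column L) ⟩
  reverse L ++ [ x ]                          ≡⟨ unfold-reverse x L ⟨
  reverse (x ∷ L) ∎
  where open ≡-Reasoning

readingWord-∷ : ∀ r T → readingWord (r ∷ T) ≡ readingWord T ++ r
readingWord-∷ r T = trans (cong concat (unfold-reverse r T))
  (trans (sym (concat-++ (reverse T) [ r ])) (cong (readingWord T ++_) (++-identityʳ r)))

trace-hook : ∀ α x y β → trace (suc (length α)) (readingWord (hookTableau (α ++ x ∷ y ∷ β)))
  ≡ hookTrace x y
trace-hook α x y β = begin
  trace i (readingWord (hook R L))             ≡⟨ cong (trace i) (readingWord-∷ R (attach L [])) ⟩
  trace i (readingWord (attach L []) ++ R)     ≡⟨ cong (λ w → trace i (w ++ R))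
    (concat-reverse-column L) ⟩
  trace i (reverse L ++ R)                     ≡⟨ trace-++ i (reverse L) R ⟩
  trace i (reverse L) ++ trace i R             ≡⟨ cong (_++ trace i R) (trace-reverse i L) ⟩
  reverse (trace i L) ++ trace i R             ≡⟨ cong₂ (λ u v → reverse u ++ v)
                                                    (trace-expand leg α x y β) (trace-expand row α x y β) ⟩
  hookTrace x y ∎
  where
  open ≡-Reasoning
  i = suc (length α)
  R = expand row 1 (α ++ x ∷ y ∷ β)
  L = expand leg 1 (α ++ x ∷ y ∷ β)

bits-swap-middle : ∀ α {x y x′ y′} β → bits (x′ ∷ y′ ∷ []) ≡ bits (x ∷ y ∷ []) →
  bits (α ++ x′ ∷ y′ ∷ β) ≡ bits (α ++ x ∷ y ∷ β)
bits-swap-middle α {x} {y} {x′} {y′} β eq =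
  trans (bits-++ α _) (trans (cong (bits α ++_) middle) (sym (bits-++ α _)))
  where
  middle : bits (x′ ∷ y′ ∷ β) ≡ bits (x ∷ y ∷ β)
  middle = trans (bits-++ (x′ ∷ y′ ∷ []) β)
    (trans (cong (_++ bits β) eq) (sym (bits-++ (x ∷ y ∷ []) β)))

s-hookTableau : ∀ α {x y} β ((swap x′ y′ _ _ _ _ _ _) : HookSwap x y) →
  s (suc (length α)) (hookTableau (α ++ x ∷ y ∷ β)) ≡ hookTableau (α ++ x′ ∷ y′ ∷ β)
s-hookTableau α {x} {y} β (swap x′ y′ _ _ _ rs ls ts) = s-unique
  (agree-expand row α x y x′ y′ β rs ∷ pointwise-attach (agree-expand leg α x y x′ y′ β ls) [])
  (trans (trace-hook α x′ y′ β) (trans ts (cong (reflectWord 0) (sym (trace-hook α x y β)))))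

hookCode-s : ∀ {n} a x y b {w T} → HookCode n (a ++ x ∷ y ∷ b) w T →
  HookCode n (a ++ y ∷ x ∷ b) w (s (suc (length a)) T)
hookCode-s a x y b (code σ len cσ bσ refl) with map≡++ hookContent σ a (x ∷ y ∷ b) cσ
... | α , p ∷ q ∷ β , refl , refl , refl with hookSwap p q
...   | sw@(swap p′ q′ cx cy bs _ _ _) = code (α ++ p′ ∷ q′ ∷ β)
  (trans (length-++ α) (trans (sym (length-++ α)) len))
  (trans (map-++ hookContent α _)
    (cong (map hookContent α ++_) (cong₂ (λ u v → u ∷ v ∷ map hookContent β) cx cy)))
  (trans (bits-swap-middle α β bs) bσ)
  (trans (sym (s-hookTableau α β sw))
    (cong (λ k → s (suc k) (hookTableau (α ++ p ∷ q ∷ β))) (sym (length-map hookContent α))))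

-- Promotion of hook codes

rotate : List Bool → List Bool
rotate w with reverse w
... | []    = []
... | b ∷ v = b ∷ reverse v

rotate-∷ʳ : ∀ w b → rotate (w ∷ʳ b) ≡ b ∷ w
rotate-∷ʳ w b rewrite reverse-++ w [ b ] | reverse-involutive w = refl

hookUpdate : ℕ → List Bool → List Bool
hookUpdate zero    w = w
hookUpdate (suc _) w = rotate w

hookUpdate-comm : ∀ x y w → hookUpdate x (hookUpdate y w) ≡ hookUpdate y (hookUpdate x w)
hookUpdate-comm zero    y       w = refl
hookUpdate-comm (suc x) zero    w = refl
hookUpdate-comm (suc x) (suc y) w = refl

-- The smallest letter that occurs is the corner entry.
corner-state : ∀ σ w → bits σ ≡ false ∷ w →
  ∃₂ λ m a → ∃ λ τ → σ ≡ replicate m (0 , false) ++ (suc a , false) ∷ τ × bits τ ≡ w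
corner-state ((zero , false) ∷ σ) w eq with corner-state σ w eq
... | m , a , τ , refl , eq′ = suc m , a , τ , refl , eq′
corner-state ((suc a , false) ∷ σ) w refl = 0 , a , σ , refl , refl

bits-inactive : ∀ m τ → bits (replicate m (0 , false) ++ τ) ≡ bits τ
bits-inactive zero    τ = refl
bits-inactive (suc m) τ = bits-inactive m τ

expand-inactive : ∀ {S : Set} (f : S → ℕ) {x} k m τ → f x ≡ 0 →
  expand f k (replicate m x ++ τ) ≡ expand f (k + m) τ
expand-inactive f k zero    τ eq rewrite +-identityʳ k = refl
expand-inactive f k (suc m) τ eq rewrite eq | +-suc k m = expand-inactive f (suc k) m τ eq

content-corner : ∀ m a τ → map hookContent (replicate m (0 , false) ++ (a , true) ∷ τ)
  ≡ map hookContent (replicate m (0 , false) ++ (suc a , false) ∷ τ)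
content-corner zero    a τ = cong (_∷ map hookContent τ) (trans (+-comm a 1) (sym (+-identityʳ _)))
content-corner (suc m) a τ = cong (0 ∷_) (content-corner m a τ)

length-corner : ∀ m (x y : HookState) τ →
  length (replicate m (0 , false) ++ x ∷ τ) ≡ length (replicate m (0 , false) ++ y ∷ τ)
length-corner zero    x y τ = refl
length-corner (suc m) x y τ = cong suc (length-corner m x y τ)

bits-active : ∀ x {a b} → 0 < a + bit b → bits (x ∷ʳ (a , b)) ≡ bits x ∷ʳ b
bits-active x {zero} {true} _ = bits-++ x _
bits-active x {suc a} _ = bits-++ x _

-- The smallest letter `x` loses the corner to the new entry 1 and gains a place in the leg, so its
-- state passes from `(suc a , false)` to `(a , true)` and its multiplicity is kept.
pr-hook-leg-state : ∀ m a τ d → let x = 1 + m; σ = replicate m (0 , false) ++ (suc a , false) ∷ τ in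
  pr (suc (length σ)) (hookTableau (σ ∷ʳ (d , true)))
    ≡ hookTableau ((suc d , false) ∷ replicate m (0 , false) ++ (a , true) ∷ τ)
pr-hook-leg-state m a τ d = begin
  pr n (hook (expand row 1 (σ ∷ʳ (d , true))) (expand leg 1 (σ ∷ʳ (d , true))))
    ≡⟨ cong₂ (λ R L → pr n (hook R L))
        (trans (expand-∷ʳ row 1 σ (d , true)) (cong (_++ replicate d n) row-σ))
        (trans (expand-∷ʳ leg 1 σ (d , true)) (cong (_∷ʳ n) leg-σ)) ⟩
  pr n (hook (x ∷ A ++ replicate d n) (L ∷ʳ n))
    ≡⟨ pr-hook-leg n x A L d
        (subst (All (_< n)) row-σ (expand-< row 1 σ))
          (subst (All (_< n)) leg-σ (expand-< leg 1 σ)) ⟩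
  hook (replicate (suc d) 1 ++ map suc A) (map suc (x ∷ L))
    ≡⟨ cong₂ (λ R L → hook (replicate (suc d) 1 ++ R) L)
        (trans (cong (map suc) (sym row-σ′)) (map-suc-expand row 1 σ′))
        (trans (cong (map suc) (sym leg-σ′)) (map-suc-expand leg 1 σ′)) ⟩
  hookTableau ((suc d , false) ∷ σ′) ∎
  where
  open ≡-Reasoning
  σ = replicate m (0 , false) ++ (suc a , false) ∷ τ
  σ′ = replicate m (0 , false) ++ (a , true) ∷ τ
  n = suc (length σ)
  x = 1 + m
  A = replicate a x ++ expand row (suc x) τ
  L = expand leg (suc x) τ
  row-σ : expand row 1 σ ≡ x ∷ A
  row-σ = expand-inactive row 1 m _ refl
  leg-σ : expand leg 1 σ ≡ L
  leg-σ = expand-inactive leg 1 m _ refl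
  row-σ′ : expand row 1 σ′ ≡ A
  row-σ′ = expand-inactive row 1 m _ refl
  leg-σ′ : expand leg 1 σ′ ≡ x ∷ L
  leg-σ′ = expand-inactive leg 1 m _ refl

expand-row-nonempty : ∀ k σ {w} → bits σ ≡ false ∷ w → 0 < length (expand row k σ)
expand-row-nonempty k ((zero , false) ∷ σ)  eq = expand-row-nonempty (suc k) σ eq
expand-row-nonempty k ((suc a , false) ∷ σ) eq = z<s

pr-hook-row-state : ∀ σ d {w} → bits (σ ∷ʳ (d , false)) ≡ false ∷ w →
  pr (suc (length σ)) (hookTableau (σ ∷ʳ (d , false))) ≡ hookTableau ((d , false) ∷ σ)
pr-hook-row-state σ d eq = begin
  pr n (hook (expand row 1 (σ ∷ʳ (d , false))) (expand leg 1 (σ ∷ʳ (d , false))))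
    ≡⟨ cong₂ (λ R L → pr n (hook R L)) row-σ
      (trans (expand-∷ʳ leg 1 σ (d , false)) (++-identityʳ _)) ⟩
  pr n (hook (expand row 1 σ ++ replicate d n) (expand leg 1 σ))
    ≡⟨ pr-hook-row n _ _ d (subst (λ R → 0 < length R) row-σ
      (expand-row-nonempty 1 (σ ∷ʳ (d , false)) eq))
        (expand-< row 1 σ) (expand-< leg 1 σ) ⟩
  hook (replicate d 1 ++ map suc (expand row 1 σ)) (map suc (expand leg 1 σ))
    ≡⟨ cong₂ (λ R L → hook (replicate d 1 ++ R) L) (map-suc-expand row 1 σ)
      (map-suc-expand leg 1 σ) ⟩
  hookTableau ((d , false) ∷ σ) ∎
  where
  open ≡-Reasoning
  n = suc (length σ)
  row-σ = expand-∷ʳ row 1 σ (d , false)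

length-∷ʳ : ∀ {A : Set} (xs : List A) x → length (xs ∷ʳ x) ≡ suc (length xs)
length-∷ʳ []       x = refl
length-∷ʳ (_ ∷ xs) x = cong suc (length-∷ʳ xs x)

hookUpdate-active : ∀ z w b → 0 < z → hookUpdate z (w ∷ʳ b) ≡ b ∷ w
hookUpdate-active (suc z) w b _ = rotate-∷ʳ w b

-- If `n` occurs in the row only, its bit `false` becomes the new leading bit. If it occurs in the
-- leg, the old leading bit turns into `true` and the new letter 1 adds a `false` before it. Either
-- way the bits after the leading one are rotated, with the bit of `n` coming first.
hookCode-pr : ∀ {n} c z {w T} → HookCode n (c ∷ʳ z) w T →
  HookCode n (z ∷ c) (hookUpdate z w) (pr n T)
hookCode-pr c z (code σ len cσ bσ refl) with map≡++ hookContent σ c [ z ] cσ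
hookCode-pr {n} c _ {w} (code _ len cσ bσ refl) | σ , (d , b) ∷ [] , refl , refl , refl
  with trans (sym len) (length-∷ʳ σ (d , b))
... | refl = go b d bσ
  where
  go : ∀ b d → bits (σ ∷ʳ (d , b)) ≡ false ∷ w →
    HookCode (suc (length σ)) (d + bit b ∷ map hookContent σ) (hookUpdate (d + bit b) w)
      (pr (suc (length σ)) (hookTableau (σ ∷ʳ (d , b))))
  go false zero eq = code ((0 , false) ∷ σ) refl refl
    (trans (sym (++-identityʳ _)) (trans (sym (bits-++ σ _)) eq)) (sym (pr-hook-row-state σ 0 eq))
  go false (suc d) eq = code ((suc d , false) ∷ σ) refl refl
    (cong (false ∷_) (core (bits σ) (trans (sym (bits-++ σ _)) eq)))
    (sym (pr-hook-row-state σ (suc d) eq))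
    where
    core : ∀ v {w} → v ∷ʳ false ≡ false ∷ w → v ≡ rotate w
    -- Here `n` is the only letter that occurs.
    core []          refl = refl
    core (false ∷ v) refl = sym (rotate-∷ʳ v false)
  -- Were `bits σ` empty, the leading bit would be the bit `true` of `n`. So a letter below `n`
  -- occurs and holds the corner.
  go true d eq with bits σ in bits-σ | trans (sym (bits-active σ {d} {true} (m≤n+m 1 d))) eq
  ... | false ∷ v | refl with corner-state σ v bits-σ
  ...   | m , a , τ , refl , refl =
    code ((suc d , false) ∷ replicate m (0 , false) ++ (a , true) ∷ τ)
    (cong suc (length-corner m (a , true) (suc a , false) τ))
    (cong₂ _∷_ (trans (+-identityʳ (suc d)) (+-comm 1 d)) (content-corner m a τ))
    (cong (false ∷_) (trans (bits-inactive m _) (trans (active a)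
      (sym (hookUpdate-active (d + 1) (bits τ) true (m≤n+m 1 d))))))
    (sym (pr-hook-leg-state m a τ d))
    where
    active : ∀ a → bits ((a , true) ∷ τ) ≡ true ∷ bits τ
    active zero    = refl
    active (suc a) = refl

-- Multiplicities of sorted words

expand-map : ∀ {S : Set} (f : S → ℕ) k σ → expand f k σ ≡ expand id k (map f σ)
expand-map f k []      = refl
expand-map f k (x ∷ σ) = cong (replicate (f x) k ++_) (expand-map f (suc k) σ)

split-leading : ∀ k xs → Linked _≤_ xs → All (k ≤_) xs →
  ∃₂ λ a ys → xs ≡ replicate a k ++ ys × All (suc k ≤_) ys × Linked _≤_ ys
split-leading k []       _ _ = 0 , [] , refl , [] , []
split-leading k (x ∷ xs) l (k≤x ∷ k≤xs) with x ≟ k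
... | no x≢k = 0 , x ∷ xs , refl ,
  All.map (≤-trans (≤∧≢⇒< k≤x (x≢k ∘ sym))) (Linked⇒All ≤-trans ≤-refl l) , l
... | yes refl with split-leading k xs (Linked.tail l) k≤xs
...   | a , ys , refl , p , q = suc a , ys , refl , p , q

multiplicities : ∀ k n xs → Linked _≤_ xs → All (λ x → k ≤ x × x < k + n) xs →
  ∃ λ as → length as ≡ n × expand id k as ≡ xs
multiplicities k zero    []       _ _ = [] , refl , refl
multiplicities k zero    (x ∷ xs) _ ((k≤x , x<k) ∷ _) =
  ⊥-elim (<⇒≱ x<k (subst (_≤ x) (sym (+-identityʳ k)) k≤x))
multiplicities k (suc n) xs       l r with split-leading k xs l (All.map proj₁ r)
... | a , ys , refl , p , q with multiplicities (suc k) n ys q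
      (All.zip (p , All.map (λ {x} → subst (x <_) (+-suc k n) ∘ proj₂)
        (All.++⁻ʳ (replicate a k) r)))
...   | as , refl , refl = a ∷ as , refl , refl

linked-++⁻ʳ : ∀ xs {ys} → Linked _<_ (xs ++ ys) → Linked _<_ ys
linked-++⁻ʳ []       l = l
linked-++⁻ʳ (x ∷ xs) l = linked-++⁻ʳ xs (Linked.tail l)

multiplicities-≤1 : ∀ k as → Linked _<_ (expand id k as) → All (_≤ 1) as
multiplicities-≤1 k []                 l       = []
multiplicities-≤1 k (zero ∷ as)        l       = z≤n ∷ multiplicities-≤1 (suc k) as l
multiplicities-≤1 k (suc zero ∷ as)    l       =
  ≤-refl ∷ multiplicities-≤1 (suc k) as (Linked.tail l)
multiplicities-≤1 k (suc (suc a) ∷ as) (k<k ∷ _) = ⊥-elim (<-irrefl refl k<k)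

pair-states : ∀ {S : Set} (f g : S → ℕ) {P Q : ℕ → Set} →
  (∀ {a b} → P a → Q b → ∃ λ x → f x ≡ a × g x ≡ b) →
  ∀ {as bs} → All P as → All Q bs → length as ≡ length bs →
  ∃ λ σ → map f σ ≡ as × map g σ ≡ bs
pair-states f g mk []       []       _  = [] , refl , refl
pair-states f g mk (p ∷ ps) (q ∷ qs) eq with mk p q | pair-states f g mk ps qs (suc-injective eq)
... | x , refl , refl | σ , refl , refl = x ∷ σ , refl , refl

-- `P` and `Q` carry the bounds on multiplicities, such as at most 1 in a strictly increasing
-- column, under which a pair of multiplicities comes from a state.
states : ∀ {S : Set} (f g : S → ℕ) {P Q : ℕ → Set} →
  (∀ {a b} → P a → Q b → ∃ λ x → f x ≡ a × g x ≡ b) → ∀ n {xs ys} →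
  Linked _≤_ xs → All (λ x → 1 ≤ x × x ≤ n) xs → (∀ as → expand id 1 as ≡ xs → All P as) →
  Linked _≤_ ys → All (λ x → 1 ≤ x × x ≤ n) ys → (∀ bs → expand id 1 bs ≡ ys → All Q bs) →
  ∃ λ σ → length σ ≡ n × expand f 1 σ ≡ xs × expand g 1 σ ≡ ys
states f g mk n lx rx px ly ry py
  with multiplicities 1 n _ lx (All.map (λ (p , q) → p , s≤s q) rx)
     | multiplicities 1 n _ ly (All.map (λ (p , q) → p , s≤s q) ry)
... | as , las , eas | bs , lbs , ebs
  with pair-states f g mk (px as eas) (py bs ebs) (trans las (sym lbs))
...   | σ , refl , refl = σ , trans (sym (length-map f σ)) las ,
  trans (expand-map f 1 σ) eas , trans (expand-map g 1 σ) ebs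

-- Codes of semistandard hooks

entries⇒linked : ∀ xs → (∀ r x y → head (drop r xs) ≡ just x → head (drop (suc r) xs) ≡ just y →
  x < y) →
  Linked _<_ xs
entries⇒linked []           _  = []
entries⇒linked (x ∷ [])     _  = [-]
entries⇒linked (x ∷ y ∷ xs) lt = lt 0 x y refl refl ∷ entries⇒linked (y ∷ xs) (lt ∘ suc)

all-attach : ∀ {P : ℕ → Set} xs rs → All (All P) (attach xs rs) → All P xs
all-attach []       rs       ps             = []
all-attach (x ∷ xs) []       ((p ∷ _) ∷ ps) = p ∷ all-attach xs [] ps
all-attach (x ∷ xs) (r ∷ rs) ((p ∷ _) ∷ ps) = p ∷ all-attach xs rs ps

all-attach-rest : ∀ {P : ℕ → Set} xs rs → length rs ≤ length xs → All (All P) (attach xs rs) →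
  All (All P) rs
all-attach-rest xs       []       le       ps             = []
all-attach-rest (x ∷ xs) (r ∷ rs) (s≤s le) ((_ ∷ p) ∷ ps) = p ∷ all-attach-rest xs rs le ps

column-of-shape : ∀ m (Ls : Tableau) → map length Ls ≡ replicate m 1 → ∃ λ L → Ls ≡ attach L []
column-of-shape zero    []               eq = [] , refl
column-of-shape (suc m) ((x ∷ []) ∷ Ls)  eq with column-of-shape m Ls (∷-injectiveʳ eq)
... | L , refl = x ∷ L , refl
column-of-shape (suc m) ([] ∷ Ls)          eq with ∷-injectiveˡ eq
... | ()
column-of-shape (suc m) ((_ ∷ _ ∷ _) ∷ Ls) eq with ∷-injectiveˡ eq
... | ()

-- The first letter that occurs has to be `x` and has to lie outside the leg, since otherwise the
-- leg would contain a letter that is at most `x`.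
corner-bits : ∀ k σ {x R} → expand row k σ ≡ x ∷ R → All (x <_) (expand leg k σ) →
  ∃ λ w → bits σ ≡ false ∷ w
corner-bits k ((zero , false) ∷ σ)  eq p = corner-bits (suc k) σ eq p
corner-bits k ((suc a , false) ∷ σ) eq p = bits σ , refl
corner-bits k ((suc a , true) ∷ σ)  refl (k<k ∷ _) = ⊥-elim (<-irrefl refl k<k)
corner-bits k ((zero , true) ∷ σ)   eq (x<k ∷ _) with subst (All (suc k ≤_)) eq
  (expand-≥ row (suc k) σ)
... | k<x ∷ _ = ⊥-elim (<-asym x<k k<x)

hook-code : ∀ {n x A L} → Linked _≤_ (x ∷ A) → All (λ y → 1 ≤ y × y ≤ n) (x ∷ A) →
  Linked _<_ (x ∷ L) → All (λ y → 1 ≤ y × y ≤ n) L →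
  ∃₂ λ c w → HookCode n c w (hook (x ∷ A) L)
hook-code {n} {x} {A} {L} lR rR lL rL
  with states row leg {P = λ _ → ⊤} {Q = _≤ 1} mk n lR rR (λ as _ → All.universal (λ _ → tt) as)
         (Linked.map <⇒≤ (Linked.tail lL)) rL
         (λ bs eq → multiplicities-≤1 1 bs (subst (Linked _<_) (sym eq) (Linked.tail lL)))
  where
  mk : ∀ {a b} → ⊤ → b ≤ 1 → ∃ λ y → row y ≡ a × leg y ≡ b
  mk {a} {zero}  _ _         = (a , false) , refl , refl
  mk {a} {suc _} _ (s≤s z≤n) = (a , true) , refl , refl
... | σ , len , eR , eL = _ , _ , code σ len refl
  (proj₂ (corner-bits 1 σ eR (subst (All (x <_)) (sym eL) (above lL)))) (cong₂ hook eR eL)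
  where
  above : ∀ {x L} → Linked _<_ (x ∷ L) → All (x <_) L
  above [-]       = []
  above (x<y ∷ l) = Linked⇒All <-trans x<y l

hook-coded : ∀ {n sh T} → IsHook sh → IsSST n sh T → ∃₂ λ c w → HookCode n c w T
hook-coded {T = []} (N , m , m<N , refl) sst with IsSST.shape sst
... | ()
hook-coded {T = [] ∷ _} (N , m , m<N , refl) sst =
  ⊥-elim (<⇒≢ (m<n⇒0<n∸m m<N) (∷-injectiveˡ (IsSST.shape sst)))
hook-coded {n} {T = (x ∷ A) ∷ Ls} (N , m , m<N , refl) sst
  with column-of-shape m Ls (∷-injectiveʳ (IsSST.shape sst))
... | L , refl with IsSST.rows sst | IsSST.range sst
...   | lR ∷ _ | rR ∷ rL = hook-code lR rR
  (entries⇒linked (x ∷ L) (λ r y z p q → IsSST.columns sst r 0 y z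
    (trans (entry-attach-zero (x ∷ L) [ A ] r) p)
      (trans (entry-attach-zero (x ∷ L) [ A ] (suc r)) q)))
  (all-attach L [] rL)

-- Two columns

-- Whether a letter lies in the first and in the second column.
ColumnState : Set
ColumnState = Bool × Bool

first second columnContent : ColumnState → ℕ
first  (a , _) = bit a
second (_ , b) = bit b
columnContent (a , b) = bit a + bit b

-- The letters that lie in exactly one column: false for the first, true for the second.
singles : List ColumnState → List Bool
singles []                   = []
singles ((false , false) ∷ σ) = singles σ
singles ((true , true) ∷ σ)   = singles σ
singles ((false , true) ∷ σ)  = true ∷ singles σ
singles ((true , false) ∷ σ)  = false ∷ singles σ

singles-++ : ∀ σ τ → singles (σ ++ τ) ≡ singles σ ++ singles τ
singles-++ []                   τ = refl
singles-++ ((false , false) ∷ σ) τ = singles-++ σ τ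
singles-++ ((true , true) ∷ σ)   τ = singles-++ σ τ
singles-++ ((false , true) ∷ σ)  τ = cong (true ∷_) (singles-++ σ τ)
singles-++ ((true , false) ∷ σ)  τ = cong (false ∷_) (singles-++ σ τ)

-- Multiplicities 0 and 2 determine the state; the letters of multiplicity 1 own the bits of the
-- word, in order.
columnState-unique : ∀ σ τ → map columnContent σ ≡ map columnContent τ → singles σ ≡ singles τ →
  σ ≡ τ
columnState-unique [] [] c b = refl
columnState-unique ((false , false) ∷ σ) ((false , false) ∷ τ) c b =
  cong (_ ∷_) (columnState-unique σ τ (∷-injectiveʳ c) b)
columnState-unique ((true , true) ∷ σ) ((true , true) ∷ τ) c b =
  cong (_ ∷_) (columnState-unique σ τ (∷-injectiveʳ c) b)
columnState-unique ((false , true) ∷ σ) ((false , true) ∷ τ) c b =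
  cong (_ ∷_) (columnState-unique σ τ (∷-injectiveʳ c) (∷-injectiveʳ b))
columnState-unique ((true , false) ∷ σ) ((true , false) ∷ τ) c b =
  cong (_ ∷_) (columnState-unique σ τ (∷-injectiveʳ c) (∷-injectiveʳ b))
columnState-unique ((true , true) ∷ σ) ((true , false) ∷ τ) () b
columnState-unique ((true , true) ∷ σ) ((false , false) ∷ τ) () b
columnState-unique ((false , true) ∷ σ) ((true , false) ∷ τ) c b with ∷-injectiveˡ b
... | ()
columnState-unique ((true , false) ∷ σ) ((false , true) ∷ τ) c b with ∷-injectiveˡ b
... | ()

-- Ballot paths: the height is the excess of the first column over the second
-- among the letters read so far.
data Path : ℕ → List Bool → ℕ → Set where
  done : ∀ {h} → Path h [] h
  up   : ∀ {h w e} → Path (suc h) w e → Path h (false ∷ w) e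
  down : ∀ {h w e} → Path h w e → Path (suc h) (true ∷ w) e

path-++ : ∀ {h u d v e} → Path h u d → Path d v e → Path h (u ++ v) e
path-++ done     q = q
path-++ (up p)   q = up (path-++ p q)
path-++ (down p) q = down (path-++ p q)

path-++⁻ : ∀ {h} u {v e} → Path h (u ++ v) e → ∃ λ d → Path h u d × Path d v e
path-++⁻ []          p        = _ , done , p
path-++⁻ (false ∷ u) (up p)   with path-++⁻ u p
... | d , q , r = d , up q , r
path-++⁻ (true ∷ u)  (down p) with path-++⁻ u p
... | d , q , r = d , down q , r

path-lift : ∀ {h w e} → Path h w e → Path (suc h) w (suc e)
path-lift done     = done
path-lift (up p)   = up (path-lift p)
path-lift (down p) = down (path-lift p)

path-length : ∀ {h e} k σ → Path h (singles σ) e →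
  h + length (expand first k σ) ≡ e + length (expand second k σ)
path-length k []                    done = refl
path-length k ((false , false) ∷ σ) p    = path-length (suc k) σ p
path-length {h} {e} k ((true , true) ∷ σ) p =
  trans (+-suc h _) (trans (cong suc (path-length (suc k) σ p)) (sym (+-suc e _)))
path-length {h} k ((true , false) ∷ σ) (up p) = trans (+-suc h _) (path-length (suc k) σ p)
path-length {e = e} k ((false , true) ∷ σ) (down p) =
  trans (cong suc (path-length (suc k) σ p)) (sym (+-suc e _))

-- The first list may be the longer one, as for the columns of a tableau.
data Dominated : List ℕ → List ℕ → Set where
  []  : ∀ {xs} → Dominated xs []
  _∷_ : ∀ {x y xs ys} → x ≤ y → Dominated xs ys → Dominated (x ∷ xs) (y ∷ ys)

dominated-length : ∀ {xs ys} → Dominated xs ys → length ys ≤ length xs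
dominated-length []      = z≤n
dominated-length (_ ∷ d) = s≤s (dominated-length d)

dominated-split : ∀ {xs ys} → Dominated xs ys → ∃₂ λ (V : List (ℕ × ℕ)) zs →
  xs ≡ map proj₁ V ++ zs × ys ≡ map proj₂ V × All (λ (x , y) → x ≤ y) V
dominated-split {xs} [] = [] , xs , refl , refl , []
dominated-split (_∷_ {x} {y} p d) with dominated-split d
... | V , zs , refl , refl , q = (x , y) ∷ V , zs , refl , refl , p ∷ q

dominated-cons : ∀ {k xs} h {ys} → All (k ≤_) ys → Dominated xs (drop (suc h) ys) →
  Dominated (k ∷ xs) (drop h ys)
dominated-cons zero    []       d = []
dominated-cons zero    (p ∷ _)  d = p ∷ d
dominated-cons (suc h) []       d = []
dominated-cons (suc h) (_ ∷ ps) d = dominated-cons h ps d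

-- Before letter `k` the first column is `h` cells ahead. The next `h` entries of the second column
-- thus face earlier letters, and the comparison with the remaining first column starts after them.
path⇒dominated : ∀ {h e} k σ → Path h (singles σ) e →
  Dominated (expand first k σ) (drop h (expand second k σ))
path⇒dominated {h} k [] done = subst (Dominated []) (sym (drop-[] h)) []
path⇒dominated k ((false , false) ∷ σ) p = path⇒dominated (suc k) σ p
path⇒dominated {zero} k ((true , true) ∷ σ) p = ≤-refl ∷ path⇒dominated (suc k) σ p
path⇒dominated {suc h} k ((true , true) ∷ σ) p =
  dominated-cons h (All.map (≤-trans (n≤1+n k)) (expand-≥ second (suc k) σ))
    (path⇒dominated (suc k) σ p)
path⇒dominated {h} k ((true , false) ∷ σ) (up p) =
  dominated-cons h (All.map (≤-trans (n≤1+n k)) (expand-≥ second (suc k) σ))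
    (path⇒dominated (suc k) σ p)
path⇒dominated k ((false , true) ∷ σ) (down p) = path⇒dominated (suc k) σ p

dominated-tail : ∀ {k xs} h ys → Dominated (k ∷ xs) (drop h ys) → Dominated xs (drop (suc h) ys)
dominated-tail zero    []       []      = []
dominated-tail zero    (_ ∷ ys) (_ ∷ d) = d
dominated-tail (suc h) []       _       = []
dominated-tail (suc h) (_ ∷ ys) d       = dominated-tail h ys d

dominated⇒path : ∀ h k σ → Dominated (expand first k σ) (drop h (expand second k σ)) →
  ∃ λ e → Path h (singles σ) e
dominated⇒path h k [] d = h , done
dominated⇒path h k ((false , false) ∷ σ) d = dominated⇒path h (suc k) σ d
dominated⇒path zero k ((true , true) ∷ σ) (_ ∷ d) = dominated⇒path zero (suc k) σ d
dominated⇒path (suc h) k ((true , true) ∷ σ) d =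
  dominated⇒path (suc h) (suc k) σ (dominated-tail h _ d)
dominated⇒path h k ((true , false) ∷ σ) d with dominated⇒path (suc h) (suc k) σ
  (dominated-tail h _ d)
... | e , p = e , up p
dominated⇒path (suc h) k ((false , true) ∷ σ) d with dominated⇒path h (suc k) σ d
... | e , p = e , down p
-- At height 0 the entry `k` of the second column would have a larger letter to its left.
dominated⇒path zero k ((false , true) ∷ σ) d = ⊥-elim (absurd d (expand-≥ first (suc k) σ))
  where
  absurd : ∀ {xs ys} → Dominated xs (k ∷ ys) → All (suc k ≤_) xs → Data.Empty.⊥
  absurd (x≤k ∷ _) (k<x ∷ _) = <⇒≱ k<x x≤k

twoColumns : {A : Set} → List A → List A → List (List A)
twoColumns X Y = attach X (attach Y [])

columnTableau : List ColumnState → Tableau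
columnTableau σ = twoColumns (expand first 1 σ) (expand second 1 σ)

-- The ballot condition expresses that the rows weakly increase. It concerns `w` alone, so
-- reflections carry it over unchanged.
ColumnCore : List ColumnState → List Bool → Set
ColumnCore σ w = singles σ ≡ w × ∃ (Path 0 w)

ColumnCode : ℕ → List ℕ → List Bool → Tableau → Set
ColumnCode = StateCode columnContent ColumnCore columnTableau

columnCode-length : ∀ {n c w T} → ColumnCode n c w T → length c ≡ n
columnCode-length (code σ len refl _ _) = trans (length-map columnContent σ) len

columnCode-unique : ∀ {n c w T T′} → ColumnCode n c w T → ColumnCode n c w T′ → T ≡ T′
columnCode-unique (code σ _ cσ (bσ , _) refl) (code τ _ cτ (bτ , _) refl) =
  cong columnTableau (columnState-unique σ τ (trans cσ (sym cτ)) (trans bσ (sym bτ)))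

-- The bottom row is read first.
readRows : List (List ℕ) → List (List ℕ) → List ℕ
readRows []       []       = []
readRows []       (b ∷ bs) = readRows [] bs ++ b
readRows (a ∷ as) []       = readRows as [] ++ a
readRows (a ∷ as) (b ∷ bs) = readRows as bs ++ a ++ b

-- Traces and reflections of two columns

trace-columns : ∀ i X Y → length Y ≤ length X →
  trace i (readingWord (twoColumns X Y)) ≡ readRows (map (traceLetter i) X) (map (traceLetter i) Y)
trace-columns i []      []      _ = refl
trace-columns i (x ∷ X) []      _ = begin
  trace i (readingWord ([ x ] ∷ attach X []))       ≡⟨ cong (trace i)
    (readingWord-∷ [ x ] (attach X [])) ⟩
  trace i (readingWord (attach X []) ++ [ x ])      ≡⟨ trace-++ i
    (readingWord (attach X [])) [ x ] ⟩
  trace i (readingWord (attach X [])) ++ trace i [ x ]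
    ≡⟨ cong₂ _++_ (trace-columns i X [] z≤n) (++-identityʳ (traceLetter i x)) ⟩
  readRows (map (traceLetter i) X) [] ++ traceLetter i x ∎
  where open ≡-Reasoning
trace-columns i (x ∷ X) (y ∷ Y) (s≤s le) = begin
  trace i (readingWord ((x ∷ y ∷ []) ∷ twoColumns X Y)) ≡⟨ cong (trace i)
    (readingWord-∷ (x ∷ y ∷ []) (twoColumns X Y)) ⟩
  trace i (readingWord (twoColumns X Y) ++ x ∷ y ∷ [])  ≡⟨ trace-++ i
    (readingWord (twoColumns X Y)) (x ∷ y ∷ []) ⟩
  trace i (readingWord (twoColumns X Y)) ++ trace i (x ∷ y ∷ [])
    ≡⟨ cong₂ (λ u v → u ++ traceLetter i x ++ v) (trace-columns i X Y le)
      (++-identityʳ (traceLetter i y)) ⟩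
  readRows (map (traceLetter i) X) (map (traceLetter i) Y) ++ traceLetter i x ++ traceLetter i y ∎
  where open ≡-Reasoning

readRows-leading : ∀ q as bs →
  readRows (replicate q [] ++ as) (replicate q [] ++ bs) ≡ readRows as bs
readRows-leading zero    as bs = refl
readRows-leading (suc q) as bs = trans (++-identityʳ _) (readRows-leading q as bs)

readRows-leading-[] : ∀ q as → readRows (replicate q [] ++ as) [] ≡ readRows as []
readRows-leading-[] zero    as = refl
readRows-leading-[] (suc q) as = trans (++-identityʳ _) (readRows-leading-[] q as)

readRows-empty : ∀ p q → readRows (replicate p []) (replicate q []) ≡ []
readRows-empty zero    zero    = refl
readRows-empty zero    (suc q) = trans (++-identityʳ _) (readRows-empty zero q)
readRows-empty (suc p) zero    = trans (++-identityʳ _) (readRows-empty p zero)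
readRows-empty (suc p) (suc q) = trans (++-identityʳ _) (readRows-empty p q)

readRows-trailing : ∀ as bs p q →
  readRows (as ++ replicate p []) (bs ++ replicate q []) ≡ readRows as bs
readRows-trailing []       []       p       q       = readRows-empty p q
readRows-trailing []       (b ∷ bs) zero    q       = cong (_++ b) (readRows-trailing [] bs 0 q)
readRows-trailing []       (b ∷ bs) (suc p) q       = cong (_++ b) (readRows-trailing [] bs p q)
readRows-trailing (a ∷ as) []       p       zero    = cong (_++ a) (readRows-trailing as [] p 0)
readRows-trailing (a ∷ as) []       p       (suc q) =
  cong₂ _++_ (readRows-trailing as [] p q) (++-identityʳ a)
readRows-trailing (a ∷ as) (b ∷ bs) p       q       =
  cong (_++ a ++ b) (readRows-trailing as bs p q)

map-traceLetter-other : ∀ {i w} → All (λ x → x ≢ i × x ≢ suc i) w →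
  map (traceLetter i) w ≡ replicate (length w) []
map-traceLetter-other []             = refl
map-traceLetter-other ((p , q) ∷ ps) = cong₂ _∷_ (traceLetter-other p q) (map-traceLetter-other ps)

cells : (ColumnState → ℕ) → ColumnState → ColumnState → List (List ℕ)
cells f x y = replicate (f x) [ 0 ] ++ replicate (f y) [ 1 ]

-- `d` is the height of the path before the letter i: the rows filled by smaller letters in both
-- columns drop out, and the first column resumes `d` rows below the second.
columnTrace : ℕ → ColumnState → ColumnState → List ℕ
columnTrace d x y = readRows (replicate d [] ++ cells first x y) (cells second x y)

map-traceLetter-expand : ∀ (f : ColumnState → ℕ) α x y β → let i = suc (length α) in
  map (traceLetter i) (expand f 1 (α ++ x ∷ y ∷ β))
    ≡ replicate (length (expand f 1 α)) [] ++ cells f x y ++ replicate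
      (length (expand f (2 + i) β)) []
map-traceLetter-expand f α x y β = begin
  map (traceLetter i) (expand f 1 (α ++ x ∷ y ∷ β))
    ≡⟨ cong (map (traceLetter i)) (expand-split f α x y β) ⟩
  map (traceLetter i) (expand f 1 α ++ (replicate (f x) i ++ replicate (f y) (suc i)) ++ expand f
    (2 + i) β)
    ≡⟨ map-++ (traceLetter i) (expand f 1 α) _ ⟩
  _ ≡⟨ cong₂ _++_ (map-traceLetter-other (All.map below-other (expand-< f 1 α)))
        (trans (map-++ (traceLetter i) (replicate (f x) i ++ replicate (f y) (suc i)) _)
          (cong₂ _++_
            (trans (map-++ (traceLetter i) (replicate (f x) i) _)
              (cong₂ _++_
                (trans (map-replicate (traceLetter i) (f x) i)
                  (cong (replicate (f x)) (traceLetter-low i)))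
                (trans (map-replicate (traceLetter i) (f y) (suc i))
                  (cong (replicate (f y)) (traceLetter-high i)))))
            (map-traceLetter-other (All.map above-other (expand-≥ f (2 + i) β))))) ⟩
  _ ∎
  where
  open ≡-Reasoning
  i = suc (length α)

replicate-+ : ∀ {A : Set} m k (x : A) ys →
  replicate (m + k) x ++ ys ≡ replicate m x ++ replicate k x ++ ys
replicate-+ zero    k x ys = refl
replicate-+ (suc m) k x ys = cong (x ∷_) (replicate-+ m k x ys)

path⇒length-≤ : ∀ {e} k σ → Path 0 (singles σ) e →
  length (expand second k σ) ≤ length (expand first k σ)
path⇒length-≤ {e} k σ p = subst (length (expand second k σ) ≤_) (sym (path-length k σ p))
  (m≤n+m _ e)

trace-columnTableau : ∀ α x y β {d e} → Path 0 (singles α) d → Path 0 (singles (α ++ x ∷ y ∷ β)) e →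
  trace (suc (length α)) (readingWord (columnTableau (α ++ x ∷ y ∷ β))) ≡ columnTrace d x y
trace-columnTableau α x y β {d} p q = begin
  trace i (readingWord (twoColumns (expand first 1 σ) (expand second 1 σ)))
    ≡⟨ trace-columns i (expand first 1 σ) (expand second 1 σ) (path⇒length-≤ 1 σ q) ⟩
  readRows (map (traceLetter i) (expand first 1 σ)) (map (traceLetter i) (expand second 1 σ))
    ≡⟨ cong₂ readRows (map-traceLetter-expand first α x y β)
      (map-traceLetter-expand second α x y β) ⟩
  readRows (replicate (length (expand first 1 α)) [] ++ cells first x y ++ replicate P [])
           (replicate Q₀ [] ++ cells second x y ++ replicate Q [])
    ≡⟨ cong (λ m → readRows (replicate m [] ++ cells first x y ++ replicate P [])
                            (replicate Q₀ [] ++ cells second x y ++ replicate Q []))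
         (trans (path-length 1 α p) (+-comm d Q₀)) ⟩
  readRows (replicate (Q₀ + d) [] ++ cells first x y ++ replicate P [])
           (replicate Q₀ [] ++ cells second x y ++ replicate Q [])
    ≡⟨ cong (λ as → readRows as (replicate Q₀ [] ++ cells second x y ++ replicate Q []))
      (replicate-+ Q₀ d [] _) ⟩
  readRows (replicate Q₀ [] ++ replicate d [] ++ cells first x y ++ replicate P [])
           (replicate Q₀ [] ++ cells second x y ++ replicate Q [])
    ≡⟨ readRows-leading Q₀ _ _ ⟩
  readRows (replicate d [] ++ cells first x y ++ replicate P [])
    (cells second x y ++ replicate Q [])
    ≡⟨ cong (λ as → readRows as (cells second x y ++ replicate Q []))
      (sym (++-assoc (replicate d []) (cells first x y) _)) ⟩
  readRows ((replicate d [] ++ cells first x y) ++ replicate P [])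
    (cells second x y ++ replicate Q [])
    ≡⟨ readRows-trailing (replicate d [] ++ cells first x y) (cells second x y) P Q ⟩
  columnTrace d x y ∎
  where
  open ≡-Reasoning
  i = suc (length α)
  σ = α ++ x ∷ y ∷ β
  Q₀ = length (expand second 1 α)
  P = length (expand first (2 + i) β)
  Q = length (expand second (2 + i) β)

-- At most two cells of the second column hold i or i+1, so from a lead of 2 on they share no row
-- with those of the first column, and further blank rows do not affect the reading.
columnTrace-far : ∀ d x y → columnTrace (2 + d) x y ≡ columnTrace 2 x y
columnTrace-far d x@(_ , false) y@(_ , false) rewrite readRows-leading-[] d (cells first x y) = refl
columnTrace-far d x@(_ , false) y@(_ , true)  rewrite readRows-leading-[] d (cells first x y) = refl
columnTrace-far d x@(_ , true)  y@(_ , false) rewrite readRows-leading-[] d (cells first x y) = refl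
columnTrace-far d x@(_ , true)  y@(_ , true)  rewrite readRows-leading-[] d (cells first x y) = refl

single? : ColumnState → Bool
single? (a , b) = a xor b

-- If i and i+1 each lie in exactly one column, then they occur equally often, so
-- the reflection is the identity.
swapStates : ColumnState → ColumnState → ColumnState × ColumnState
swapStates x y = if single? x ∧ single? y then (x , y) else (y , x)

-- A finite check once a lead of at least 2 is reduced to 2. For smaller leads the path rules out
-- the states in which the second column would overtake the first.
trace-swapStates : ∀ d x y {e} → Path d (singles (x ∷ y ∷ [])) e → 
  columnTrace d (proj₁ (swapStates x y)) (proj₂ (swapStates x y))
    ≡ reflectWord 0 (columnTrace d x y)
trace-swapStates (suc (suc d)) x y _ =
  trans (columnTrace-far d (proj₁ (swapStates x y)) (proj₂ (swapStates x y)))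
  (trans (far x y) (cong (reflectWord 0) (sym (columnTrace-far d x y))))
  where
  far : ∀ x y → columnTrace 2 (proj₁ (swapStates x y)) (proj₂ (swapStates x y))
    ≡ reflectWord 0 (columnTrace 2 x y)
  far (false , false) (false , false) = refl
  far (false , false) (false , true ) = refl
  far (false , false) (true  , false) = refl
  far (false , false) (true  , true ) = refl
  far (false , true ) (false , false) = refl
  far (false , true ) (false , true ) = refl
  far (false , true ) (true  , false) = refl
  far (false , true ) (true  , true ) = refl
  far (true  , false) (false , false) = refl
  far (true  , false) (false , true ) = refl
  far (true  , false) (true  , false) = refl
  far (true  , false) (true  , true ) = refl
  far (true  , true ) (false , false) = refl
  far (true  , true ) (false , true ) = refl
  far (true  , true ) (true  , false) = refl
  far (true  , true ) (true  , true ) = refl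
trace-swapStates zero          (false , false) (false , false) _ = refl
trace-swapStates (suc zero)    (false , false) (false , false) _ = refl
trace-swapStates zero          (false , false) (false , true ) ()
trace-swapStates (suc zero)    (false , false) (false , true ) _ = refl
trace-swapStates zero          (false , false) (true  , false) _ = refl
trace-swapStates (suc zero)    (false , false) (true  , false) _ = refl
trace-swapStates zero          (false , false) (true  , true ) _ = refl
trace-swapStates (suc zero)    (false , false) (true  , true ) _ = refl
trace-swapStates zero          (false , true ) (false , false) ()
trace-swapStates (suc zero)    (false , true ) (false , false) _ = refl
trace-swapStates zero          (false , true ) (false , true ) ()
trace-swapStates (suc zero)    (false , true ) (false , true ) (down ())
trace-swapStates zero          (false , true ) (true  , false) ()
trace-swapStates (suc zero)    (false , true ) (true  , false) _ = refl
trace-swapStates zero          (false , true ) (true  , true ) ()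
trace-swapStates (suc zero)    (false , true ) (true  , true ) _ = refl
trace-swapStates zero          (true  , false) (false , false) _ = refl
trace-swapStates (suc zero)    (true  , false) (false , false) _ = refl
trace-swapStates zero          (true  , false) (false , true ) _ = refl
trace-swapStates (suc zero)    (true  , false) (false , true ) _ = refl
trace-swapStates zero          (true  , false) (true  , false) _ = refl
trace-swapStates (suc zero)    (true  , false) (true  , false) _ = refl
trace-swapStates zero          (true  , false) (true  , true ) _ = refl
trace-swapStates (suc zero)    (true  , false) (true  , true ) _ = refl
trace-swapStates zero          (true  , true ) (false , false) _ = refl
trace-swapStates (suc zero)    (true  , true ) (false , false) _ = refl
trace-swapStates zero          (true  , true ) (false , true ) ()
trace-swapStates (suc zero)    (true  , true ) (false , true ) _ = refl
trace-swapStates zero          (true  , true ) (true  , false) _ = refl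
trace-swapStates (suc zero)    (true  , true ) (true  , false) _ = refl
trace-swapStates zero          (true  , true ) (true  , true ) _ = refl
trace-swapStates (suc zero)    (true  , true ) (true  , true ) _ = refl

singles-swapStates : ∀ x y → singles (proj₁ (swapStates x y) ∷ proj₂ (swapStates x y) ∷ [])
  ≡ singles (x ∷ y ∷ [])
singles-swapStates (false , false) (false , false) = refl
singles-swapStates (false , false) (false , true ) = refl
singles-swapStates (false , false) (true  , false) = refl
singles-swapStates (false , false) (true  , true ) = refl
singles-swapStates (false , true ) (false , false) = refl
singles-swapStates (false , true ) (false , true ) = refl
singles-swapStates (false , true ) (true  , false) = refl
singles-swapStates (false , true ) (true  , true ) = refl
singles-swapStates (true  , false) (false , false) = refl
singles-swapStates (true  , false) (false , true ) = refl
singles-swapStates (true  , false) (true  , false) = refl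
singles-swapStates (true  , false) (true  , true ) = refl
singles-swapStates (true  , true ) (false , false) = refl
singles-swapStates (true  , true ) (false , true ) = refl
singles-swapStates (true  , true ) (true  , false) = refl
singles-swapStates (true  , true ) (true  , true ) = refl

content-swapStates : ∀ x y →
  columnContent (proj₁ (swapStates x y))
    ≡ columnContent y × columnContent (proj₂ (swapStates x y)) ≡ columnContent x
content-swapStates (false , false) (false , false) = refl , refl
content-swapStates (false , false) (false , true ) = refl , refl
content-swapStates (false , false) (true  , false) = refl , refl
content-swapStates (false , false) (true  , true ) = refl , refl
content-swapStates (false , true ) (false , false) = refl , refl
content-swapStates (false , true ) (false , true ) = refl , refl
content-swapStates (false , true ) (true  , false) = refl , refl
content-swapStates (false , true ) (true  , true ) = refl , refl
content-swapStates (true  , false) (false , false) = refl , refl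
content-swapStates (true  , false) (false , true ) = refl , refl
content-swapStates (true  , false) (true  , false) = refl , refl
content-swapStates (true  , false) (true  , true ) = refl , refl
content-swapStates (true  , true ) (false , false) = refl , refl
content-swapStates (true  , true ) (false , true ) = refl , refl
content-swapStates (true  , true ) (true  , false) = refl , refl
content-swapStates (true  , true ) (true  , true ) = refl , refl

sum-swapStates : ∀ (f : ColumnState → ℕ) x y →
  f x + f y ≡ f (proj₁ (swapStates x y)) + f (proj₂ (swapStates x y))
sum-swapStates f x y with single? x ∧ single? y
... | true  = refl
... | false = +-comm (f x) (f y)

singles-swap-middle : ∀ α x y β → let (x′ , y′) = swapStates x y in
  singles (α ++ x′ ∷ y′ ∷ β) ≡ singles (α ++ x ∷ y ∷ β)
singles-swap-middle α x y β = let (x′ , y′) = swapStates x y in begin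
  singles (α ++ x′ ∷ y′ ∷ β)                       ≡⟨ singles-++ α (x′ ∷ y′ ∷ β) ⟩
  singles α ++ singles (x′ ∷ y′ ∷ β)               ≡⟨ cong (singles α ++_)
    (singles-++ (x′ ∷ y′ ∷ []) β) ⟩
  singles α ++ singles (x′ ∷ y′ ∷ []) ++ singles β ≡⟨ cong (λ v → singles α ++ v ++ singles β)
    (singles-swapStates x y) ⟩
  singles α ++ singles (x ∷ y ∷ []) ++ singles β   ≡⟨ cong (singles α ++_)
    (singles-++ (x ∷ y ∷ []) β) ⟨
  singles α ++ singles (x ∷ y ∷ β)                 ≡⟨ singles-++ α (x ∷ y ∷ β) ⟨
  singles (α ++ x ∷ y ∷ β) ∎
  where open ≡-Reasoning

s-columnTableau : ∀ α x y β {e} → Path 0 (singles (α ++ x ∷ y ∷ β)) e → let (x′ , y′) = swapStates x y in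
  s (suc (length α)) (columnTableau (α ++ x ∷ y ∷ β)) ≡ columnTableau (α ++ x′ ∷ y′ ∷ β)
s-columnTableau α x y β {e} p
  with path-++⁻ (singles α) (subst (λ w → Path 0 w e) (singles-++ α (x ∷ y ∷ β)) p)
... | d , pα , q with path-++⁻ (singles (x ∷ y ∷ []))
  (subst (λ w → Path d w e) (singles-++ (x ∷ y ∷ []) β) q)
...   | _ , pxy , _ = s-unique
  (pointwise-attach (agree-expand first α x y x′ y′ β (sum-swapStates first x y))
    (pointwise-attach (agree-expand second α x y x′ y′ β (sum-swapStates second x y)) []))
  (trans (trace-columnTableau α x′ y′ β pα
    (subst (λ w → Path 0 w e) (sym (singles-swap-middle α x y β)) p))
    (trans (trace-swapStates d x y pxy)
      (cong (reflectWord 0) (sym (trace-columnTableau α x y β pα p)))))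
  where
  x′ = proj₁ (swapStates x y)
  y′ = proj₂ (swapStates x y)

columnCode-s : ∀ {n} a x y b {w T} → ColumnCode n (a ++ x ∷ y ∷ b) w T →
  ColumnCode n (a ++ y ∷ x ∷ b) w (s (suc (length a)) T)
columnCode-s a x y b (code σ len cσ (refl , e , p) refl) with map≡++ columnContent σ a
  (x ∷ y ∷ b) cσ
... | α , u ∷ v ∷ β , refl , refl , refl = let (u′ , v′) = swapStates u v in code (α ++ u′ ∷ v′ ∷ β)
  (trans (length-++ α) (trans (sym (length-++ α)) len))
  (trans (map-++ columnContent α _)
    (cong (map columnContent α ++_) (cong₂ (λ c d → c ∷ d ∷ map columnContent β)
      (proj₁ (content-swapStates u v)) (proj₂ (content-swapStates u v)))))
  (singles-swap-middle α u v β , e , p)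
  (trans (sym (s-columnTableau α u v β p))
    (cong (λ k → s (suc k) (columnTableau (α ++ u ∷ v ∷ β))) (sym (length-map columnContent α))))

-- Promotion of two columns

all-reverse : ∀ {A : Set} {P : A → Set} {xs} → All P xs → All P (reverse xs)
all-reverse []                     = []
all-reverse {xs = x ∷ xs} (p ∷ ps) =
  subst (All _) (sym (unfold-reverse x xs)) (All.∷ʳ⁺ (all-reverse ps) p)

map-twoColumns : ∀ {A B : Set} (f : A → B) X Y →
  map (map f) (twoColumns X Y) ≡ twoColumns (map f X) (map f Y)
map-twoColumns f X Y = trans (map-attach f X (attach Y []))
  (cong (attach (map f X)) (map-attach f Y []))

entry-first : ∀ (X Y : List ℕ) r → entry (twoColumns X Y) r 0 ≡ head (drop r X)
entry-first X Y = entry-attach-zero X (attach Y [])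

module _ (X Y : List ℕ) (Y≤X : length Y ≤ length X) where

  private
    rest≤X : length (attach Y []) ≤ length X
    rest≤X = subst (_≤ length X) (sym (length-attach Y [])) Y≤X

  entry-second : ∀ r → entry (twoColumns X Y) r 1 ≡ head (drop r Y)
  entry-second r = trans (entry-attach-suc X (attach Y []) r 0 rest≤X) (entry-attach-zero Y [] r)

  slideAll-twoColumns : ∀ n → let T = twoColumns X Y in
    slideAll n T ≡ slideColumn n T (slideColumn n T (dotted n T) 0) 1
  slideAll-twoColumns n = slideAll-columns n (twoColumns X Y) 2 none
    where
    none : ∀ r c → 2 ≤ c → entry (twoColumns X Y) r c ≢ just n
    none r (suc (suc c)) _ = just≢nothing
      (trans (entry-attach-suc X (attach Y []) r (suc c) rest≤X) (entry-leg-suc Y r c))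
    none r (suc zero) (s≤s ())

  slideColumn-second-none : ∀ n → All (_< n) Y → ∀ g → slideColumn n (twoColumns X Y) g 1 ≡ g
  slideColumn-second-none n p = slideColumn-none n (twoColumns X Y) 1
    (λ r eq → head-drop-∉ Y r p (trans (sym (entry-second r)) eq))

slideColumn-first-none : ∀ n X Y → All (_< n) X → ∀ g → slideColumn n (twoColumns X Y) g 0 ≡ g
slideColumn-first-none n X Y p = slideColumn-none n (twoColumns X Y) 0
  (λ r eq → head-drop-∉ X r p (trans (sym (entry-first X Y r)) eq))

slideColumn-first-last : ∀ n X Y → All (_< n) X → ∀ g →
  slideColumn n (twoColumns (X ∷ʳ n) Y) g 0 ≡ slide (length X) 0 g
slideColumn-first-last n X Y p = slideColumn-single n (twoColumns (X ∷ʳ n) Y) 0 (length X)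
  (trans (entry-first (X ∷ʳ n) Y (length X)) (head-drop-last X))
  (λ r eq → head-drop-last-unique X r p (trans (sym (entry-first (X ∷ʳ n) Y r)) eq))

slideColumn-second-last : ∀ n X Y → length (Y ∷ʳ n) ≤ length X → All (_< n) Y → ∀ g →
  slideColumn n (twoColumns X (Y ∷ʳ n)) g 1 ≡ slide (length Y) 1 g
slideColumn-second-last n X Y le p = slideColumn-single n (twoColumns X (Y ∷ʳ n)) 1 (length Y)
  (trans (entry-second X (Y ∷ʳ n) le (length Y)) (head-drop-last Y))
  (λ r eq → head-drop-last-unique Y r p (trans (sym (entry-second X (Y ∷ʳ n) le r)) eq))

fill-twoColumns : ∀ (X Y : List (Maybe ℕ)) {X′ Y′} →
  map (maybe′ suc 1) X ≡ X′ → map (maybe′ suc 1) Y ≡ Y′ →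
  map (map (maybe′ suc 1)) (twoColumns X Y) ≡ twoColumns X′ Y′
fill-twoColumns X Y refl refl = map-twoColumns (maybe′ suc 1) X Y

dotted-twoColumns : ∀ n X Y {X′ Y′} → map (dot n) X ≡ X′ → map (dot n) Y ≡ Y′ →
  dotted n (twoColumns X Y) ≡ twoColumns X′ Y′
dotted-twoColumns n X Y refl refl = map-twoColumns (dot n) X Y

slide-climb-++ : ∀ hs ys X Y → Dominated X Y → length hs ≡ suc (length ys) →
  slide (length Y + length ys) 1 (twoColumns (hs ʳ++ map just X) (ys ʳ++ (map just Y ∷ʳ nothing)))
    ≡ slide (length ys) 1 (twoColumns (hs ʳ++ map just X) (ys ʳ++ nothing ∷ map just Y))
slide-climb-++ hs ys X Y d len with dominated-split d
... | V , zs , refl , refl , p = begin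
  slide (length (map proj₂ V) + length ys) 1
    (twoColumns (hs ʳ++ map just (map proj₁ V ++ zs)) (ys ʳ++ (map just (map proj₂ V) ∷ʳ nothing)))
    ≡⟨ cong₂ (λ k G → slide (k + length ys) 1 G) lengths
      (cong₂ twoColumns left (right [] [ nothing ] refl)) ⟩
  slide (length (reverse V) + length ys) 1
    (twoColumns (hs ʳ++ (map (just ∘ proj₁) (reverse V) ʳ++ map just zs))
                (ys ʳ++ (map (just ∘ proj₂) (reverse V) ʳ++ nothing ∷ [])))
    ≡⟨ slide-climb hs ys (reverse V) (map just zs) [] len (all-reverse p) ⟩
  slide (length ys) 1
    (twoColumns (hs ʳ++ (map (just ∘ proj₁) (reverse V) ʳ++ map just zs))
                (ys ʳ++ nothing ∷ (map (just ∘ proj₂) (reverse V) ʳ++ [])))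
    ≡⟨ cong (slide (length ys) 1) (cong₂ twoColumns (sym left)
      (sym (right [ nothing ] [] (++-identityʳ _)))) ⟩
  slide (length ys) 1
    (twoColumns (hs ʳ++ map just (map proj₁ V ++ zs)) (ys ʳ++ nothing ∷ map just (map proj₂ V))) ∎
  where
  open ≡-Reasoning
  lengths : length (map proj₂ V) ≡ length (reverse V)
  lengths = trans (length-map proj₂ V) (sym (length-reverse V))
  left : hs ʳ++ map just (map proj₁ V ++ zs)
    ≡ hs ʳ++ (map (just ∘ proj₁) (reverse V) ʳ++ map just zs)
  left = cong (hs ʳ++_) (trans (map-++ just (map proj₁ V) zs)
    (trans (cong (_++ map just zs) (sym (map-∘ V)))
      (sym (map-reverse-ʳ++ (just ∘ proj₁) V (map just zs)))))
  -- Serves both ends of the climb: the dot is in `vs`, below the column, at the start and in `us`,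
  -- above it, at the end.
  right : ∀ us vs {ws} → map just (map proj₂ V) ++ vs ≡ ws →
    ys ʳ++ (us ++ ws) ≡ ys ʳ++ (us ++ (map (just ∘ proj₂) (reverse V) ʳ++ vs))
  right us vs refl = cong (λ ws → ys ʳ++ (us ++ ws))
    (trans (cong (_++ vs) (sym (map-∘ V))) (sym (map-reverse-ʳ++ (just ∘ proj₂) V vs)))

module _ (n : ℕ) where

  pr-neither : ∀ X Y → length Y ≤ length X → All (_< n) X → All (_< n) Y →
    pr n (twoColumns X Y) ≡ twoColumns (map suc X) (map suc Y)
  pr-neither X Y le pX pY = trans (cong (map (map (maybe′ suc 1))) slides)
    (fill-twoColumns (map just X) (map just Y) (map-fill X) (map-fill Y))
    where
    open ≡-Reasoning
    T₀ = twoColumns X Y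
    slides : slideAll n T₀ ≡ twoColumns (map just X) (map just Y)
    slides = begin
      slideAll n T₀ ≡⟨ slideAll-twoColumns X Y le n ⟩
      slideColumn n T₀ (slideColumn n T₀
        (dotted n T₀) 0) 1 ≡⟨ slideColumn-second-none X Y le n pY _ ⟩
      slideColumn n T₀ (dotted n T₀) 0 ≡⟨ slideColumn-first-none n X Y pX _ ⟩
      dotted n T₀ ≡⟨ dotted-twoColumns n X Y (map-dot-< pX) (map-dot-< pY) ⟩
      twoColumns (map just X) (map just Y) ∎

  slide-first-last : ∀ X Y {Y′} → All (_< n) X → map (dot n) Y ≡ Y′ → let T = twoColumns (X ∷ʳ n) Y in
    slideColumn n T (dotted n T) 0 ≡ twoColumns (nothing ∷ map just X) Y′
  slide-first-last X Y {Y′} pX eq = begin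
    slideColumn n T₀ (dotted n T₀) 0 ≡⟨ slideColumn-first-last n X Y pX _ ⟩
    slide (length X) 0 (dotted n T₀) ≡⟨ cong (slide (length X) 0)
      (dotted-twoColumns n (X ∷ʳ n) Y (map-dot-row n X 1 pX) eq) ⟩
    slide (length X) 0 (twoColumns (map just X ∷ʳ nothing) Y′) ≡⟨ slide-column-++ X []
      (attach Y′ []) ⟩
    twoColumns (nothing ∷ (map just X ++ [])) Y′ ≡⟨ cong (λ xs → twoColumns (nothing ∷ xs) Y′)
      (++-identityʳ (map just X)) ⟩
    twoColumns (nothing ∷ map just X) Y′ ∎
    where
    open ≡-Reasoning
    T₀ = twoColumns (X ∷ʳ n) Y

  pr-first : ∀ X Y → length Y ≤ length (X ∷ʳ n) → All (_< n) X → All (_< n) Y →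
    pr n (twoColumns (X ∷ʳ n) Y) ≡ twoColumns (1 ∷ map suc X) (map suc Y)
  pr-first X Y le pX pY = trans (cong (map (map (maybe′ suc 1))) slides)
    (fill-twoColumns (nothing ∷ map just X) (map just Y) (cong (1 ∷_) (map-fill X)) (map-fill Y))
    where
    open ≡-Reasoning
    T₀ = twoColumns (X ∷ʳ n) Y
    slides : slideAll n T₀ ≡ twoColumns (nothing ∷ map just X) (map just Y)
    slides = begin
      slideAll n T₀ ≡⟨ slideAll-twoColumns (X ∷ʳ n) Y le n ⟩
      slideColumn n T₀ (slideColumn n T₀ (dotted n T₀) 0) 1 ≡⟨ slideColumn-second-none
        (X ∷ʳ n) Y le n pY _ ⟩
      slideColumn n T₀ (dotted n T₀) 0 ≡⟨ slide-first-last X Y pX (map-dot-< pY) ⟩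
      twoColumns (nothing ∷ map just X) (map just Y) ∎

  -- The first dot rises and shifts `X` down by one row. The second dot then always compares numbers
  -- that used to share a row, so by dominance it goes straight up, and at the top it is stopped by
  -- the first dot on its left.
  pr-both : ∀ X Y → length (Y ∷ʳ n) ≤ length (X ∷ʳ n) → All (_< n) X → All (_< n) Y →
    Dominated X Y →
    pr n (twoColumns (X ∷ʳ n) (Y ∷ʳ n)) ≡ twoColumns (1 ∷ map suc X) (1 ∷ map suc Y)
  pr-both X Y le pX pY d = trans (cong (map (map (maybe′ suc 1))) slides)
    (fill-twoColumns (nothing ∷ map just X) (nothing ∷ map just Y) (cong (1 ∷_) (map-fill X))
      (cong (1 ∷_) (map-fill Y)))
    where
    open ≡-Reasoning
    T₀ = twoColumns (X ∷ʳ n) (Y ∷ʳ n)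
    slides : slideAll n T₀ ≡ twoColumns (nothing ∷ map just X) (nothing ∷ map just Y)
    slides = begin
      slideAll n T₀ ≡⟨ slideAll-twoColumns (X ∷ʳ n) (Y ∷ʳ n) le n ⟩
      slideColumn n T₀ (slideColumn n T₀ (dotted n T₀) 0) 1 ≡⟨ slideColumn-second-last n
        (X ∷ʳ n) Y le pY _ ⟩
      slide (length Y) 1 (slideColumn n T₀ (dotted n T₀) 0)
        ≡⟨ cong₂ (λ k G → slide k 1 G) (sym (+-identityʳ (length Y)))
             (slide-first-last X (Y ∷ʳ n) pX (map-dot-row n Y 1 pY)) ⟩
      slide (length Y + 0) 1 (twoColumns (nothing ∷ map just X) (map just Y ∷ʳ nothing))
        ≡⟨ slide-climb-++ [ nothing ] [] X Y d refl ⟩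
      twoColumns (nothing ∷ map just X) (nothing ∷ map just Y) ∎

  -- The dot climbs the second column up to the row of m, where it crosses over.
  pr-second : ∀ U m X V Y → let xs = U ++ m ∷ X; ys = V ++ Y in
    length U ≡ length V → All (_< m) V → length (ys ∷ʳ n) ≤ length xs →
    All (_< n) xs → All (_< n) ys → Dominated X Y →
    pr n (twoColumns xs (ys ∷ʳ n)) ≡ twoColumns (1 ∷ map suc (U ++ X)) (map suc (V ++ m ∷ Y))
  pr-second U m X V Y len V<m le pX pY d = trans (cong (map (map (maybe′ suc 1))) slides)
    (fill-twoColumns (nothing ∷ map just (U ++ X)) (map just (V ++ m ∷ Y))
      (cong (1 ∷_) (map-fill (U ++ X))) (map-fill (V ++ m ∷ Y)))
    where
    open ≡-Reasoning
    xs = U ++ m ∷ X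
    ys = V ++ Y
    T₀ = twoColumns xs (ys ∷ʳ n)
    hs = map just (m ∷ reverse U)
    vs = map just (reverse V)
    unreverse : ∀ us ws → map just (reverse us) ʳ++ map just ws ≡ map just (us ++ ws)
    unreverse us ws = trans (map-reverse-ʳ++ just us (map just ws)) (sym (map-++ just us ws))
    len-vs : length vs ≡ length V
    len-vs = trans (length-map just (reverse V)) (length-reverse V)
    len-hs : length hs ≡ suc (length vs)
    len-hs = cong suc (trans (length-map just (reverse U))
      (trans (length-reverse U) (trans len (sym len-vs))))
    head-reverse : ∀ ws → All (_< m) ws → maybe′ (_< m) ⊤ (head ws)
    head-reverse []      _       = tt
    head-reverse (w ∷ _) (p ∷ _) = p
    slides : slideAll n T₀ ≡ twoColumns (nothing ∷ map just (U ++ X)) (map just (V ++ m ∷ Y))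
    slides = begin
      slideAll n T₀ ≡⟨ slideAll-twoColumns xs (ys ∷ʳ n) le n ⟩
      slideColumn n T₀ (slideColumn n T₀
        (dotted n T₀) 0) 1 ≡⟨ slideColumn-second-last n xs ys le pY _ ⟩
      slide (length ys) 1 (slideColumn n T₀ (dotted n T₀) 0)
        ≡⟨ cong (slide (length ys) 1) (trans (slideColumn-first-none n xs (ys ∷ʳ n) pX _)
             (dotted-twoColumns n xs (ys ∷ʳ n) (map-dot-< pX) (map-dot-row n ys 1 pY))) ⟩
      slide (length ys) 1 (twoColumns (map just xs) (map just ys ∷ʳ nothing))
        ≡⟨ cong₂ (λ k G → slide k 1 G)
             (trans (length-++ V) (trans (+-comm (length V) (length Y))
               (cong (length Y +_) (sym len-vs))))
             (cong₂ twoColumns (sym (unreverse U (m ∷ X)))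
               (trans (cong (_∷ʳ nothing) (map-++ just V Y))
                 (trans (++-assoc (map just V) (map just Y) [ nothing ])
                 (sym (map-reverse-ʳ++ just V (map just Y ∷ʳ nothing)))))) ⟩
      slide (length Y + length vs) 1
        (twoColumns (hs ʳ++ map just X) (vs ʳ++ (map just Y ∷ʳ nothing)))
        ≡⟨ slide-climb-++ hs vs X Y d len-hs ⟩
      slide (length vs) 1 (twoColumns (hs ʳ++ map just X) (vs ʳ++ nothing ∷ map just Y))
        ≡⟨ cong (λ k → slide k 1 (twoColumns (hs ʳ++ map just X) (vs ʳ++ nothing ∷ map just Y)))
          (length-map just (reverse V)) ⟩
      slide (length (reverse V)) 1 (twoColumns (hs ʳ++ map just X) (vs ʳ++ nothing ∷ map just Y))
        ≡⟨ slide-cross (reverse U) (reverse V) m (map just X) (map just Y)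
             (trans (length-reverse U) (trans len (sym (length-reverse V))))
               (head-reverse _ (all-reverse V<m)) ⟩
      twoColumns (nothing ∷ (map just (reverse U) ʳ++ map just X)) (vs ʳ++ just m ∷ map just Y)
        ≡⟨ cong₂ (λ us ws → twoColumns (nothing ∷ us) ws) (unreverse U X) (unreverse V (m ∷ Y)) ⟩
      twoColumns (nothing ∷ map just (U ++ X)) (map just (V ++ m ∷ Y)) ∎

-- Replaces the last false at height 0 by true.
raise : ℕ → List Bool → Maybe (List Bool)
raise h []          = nothing
raise h (true ∷ w)  = maybe′ (λ w′ → just (true ∷ w′)) nothing (raise (pred h) w)
raise h (false ∷ w) = maybe′ (λ w′ → just (false ∷ w′))
  (if h ≡ᵇ 0 then just (true ∷ w) else nothing) (raise (suc h) w)

-- Read from one level higher, the path never comes down to height 0, so no `false` qualifies.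
raise-nothing : ∀ {h w e} → Path h w e → raise (suc h) w ≡ nothing
raise-nothing done     = refl
raise-nothing (up p)   rewrite raise-nothing p = refl
raise-nothing (down p) rewrite raise-nothing p = refl

-- The `false` between `u` and `v` starts at height 0. After it `v` is read from height 1, where
-- `raise-nothing` excludes a later candidate.
raise-just : ∀ {h u v e} → Path h u 0 → Path 0 v e → raise h (u ++ false ∷ v) ≡ just (u ++ true ∷ v)
raise-just done     q rewrite raise-nothing q = refl
raise-just (up p)   q rewrite raise-just p q = refl
raise-just (down p) q rewrite raise-just p q = refl

-- The result is L w for w L, and L u R v for u L v R with u balanced and v a ballot
-- word (L = false, R = true).
promoteSingles : List Bool → List Bool
promoteSingles w with reverse w
... | []        = []
... | false ∷ v = false ∷ reverse v
... | true ∷ v  = maybe′ (false ∷_) w (raise 0 (reverse v))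

promoteSingles-false : ∀ w → promoteSingles (w ∷ʳ false) ≡ false ∷ w
promoteSingles-false w rewrite reverse-++ w [ false ] | reverse-involutive w = refl

promoteSingles-true : ∀ {u v e} → Path 0 u 0 → Path 0 v e →
  promoteSingles ((u ++ false ∷ v) ∷ʳ true) ≡ false ∷ u ++ true ∷ v
promoteSingles-true {u} {v} p q
  rewrite reverse-++ (u ++ false ∷ v) [ true ] | reverse-involutive
    (u ++ false ∷ v) | raise-just p q = refl

-- With multiplicity 0 or 2 the letter `n` contributes nothing to the word, and no number changes
-- its column: there are no dots, or both rise within their own columns.
columnUpdate : ℕ → List Bool → List Bool
columnUpdate 1 w = promoteSingles w
columnUpdate _ w = w

columnUpdate-comm : ∀ x y w → columnUpdate x (columnUpdate y w) ≡ columnUpdate y (columnUpdate x w)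
columnUpdate-comm 0             y             w = refl
columnUpdate-comm 1             0             w = refl
columnUpdate-comm 1             1             w = refl
columnUpdate-comm 1             (suc (suc y)) w = refl
columnUpdate-comm (suc (suc x)) y             w = refl

-- A path that ends above 0 either has a last step from 0 to 1 or never meets height 0, in which
-- case the whole path can be lowered by one. From the start height 0 only the former is possible.
last-ascent : ∀ h σ e → Path h (singles σ) (suc e) →
  (∃₂ λ u v → σ ≡ u ++ (true , false) ∷ v × Path h (singles u) 0 × Path 0 (singles v) e)
  ⊎ (∃ λ h′ → h ≡ suc h′ × Path h′ (singles σ) e)
last-ascent h [] e done = inj₂ (e , refl , done)
last-ascent h ((false , false) ∷ σ) e p with last-ascent h σ e p
... | inj₁ (u , v , refl , q , r) = inj₁ ((false , false) ∷ u , v , refl , q , r)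
... | inj₂ x                      = inj₂ x
last-ascent h ((true , true) ∷ σ) e p with last-ascent h σ e p
... | inj₁ (u , v , refl , q , r) = inj₁ ((true , true) ∷ u , v , refl , q , r)
... | inj₂ x                      = inj₂ x
last-ascent h ((true , false) ∷ σ) e (up p) with last-ascent (suc h) σ e p
... | inj₁ (u , v , refl , q , r) = inj₁ ((true , false) ∷ u , v , refl , up q , r)
last-ascent zero    ((true , false) ∷ σ) e (up p) | inj₂ (_ , refl , q) =
  inj₁ ([] , σ , refl , done , q)
last-ascent (suc h) ((true , false) ∷ σ) e (up p) | inj₂ (_ , refl , q) = inj₂ (h , refl , up q)
last-ascent (suc h) ((false , true) ∷ σ) e (down p) with last-ascent h σ e p
... | inj₁ (u , v , refl , q , r) = inj₁ ((false , true) ∷ u , v , refl , down q , r)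
... | inj₂ (_ , refl , q)         = inj₂ (h , refl , down q)

-- Promotion of two-column codes

path-last : ∀ σ x {e} → Path 0 (singles (σ ∷ʳ x)) e → ∃ λ d →
  Path 0 (singles σ) d × Path d (singles [ x ]) e
path-last σ x {e} p = path-++⁻ (singles σ) (subst (λ w → Path 0 w e) (singles-++ σ [ x ]) p)

module _ (σ : List ColumnState) where

  private
    n = suc (length σ)
    X = expand first 1 σ
    Y = expand second 1 σ

    snoc : ∀ (f : ColumnState → ℕ) x → expand f 1 (σ ∷ʳ x) ≡ expand f 1 σ ++ replicate (f x) n
    snoc f x = expand-∷ʳ f 1 σ x

    drop-none : ∀ (f : ColumnState → ℕ) x → f x ≡ 0 → expand f 1 (σ ∷ʳ x) ≡ expand f 1 σ
    drop-none f x eq = trans (snoc f x)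
      (trans (cong (λ m → expand f 1 σ ++ replicate m n) eq) (++-identityʳ _))

    lengths : ∀ x {e} → Path 0 (singles (σ ∷ʳ x)) e → ∀ {X′ Y′} →
      expand first 1 (σ ∷ʳ x) ≡ X′ → expand second 1 (σ ∷ʳ x) ≡ Y′ → length Y′ ≤ length X′
    lengths x p refl refl = path⇒length-≤ 1 (σ ∷ʳ x) p

    X<n : All (_< n) X
    X<n = expand-< first 1 σ

    Y<n : All (_< n) Y
    Y<n = expand-< second 1 σ

  pr-state-neither : ∀ {e} → Path 0 (singles (σ ∷ʳ (false , false))) e →
    pr n (columnTableau (σ ∷ʳ (false , false))) ≡ columnTableau ((false , false) ∷ σ)
  pr-state-neither p = begin
    pr n (columnTableau (σ ∷ʳ (false , false)))
      ≡⟨ cong₂ (λ A B → pr n (twoColumns A B)) eqX eqY ⟩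
    pr n (twoColumns X Y)
      ≡⟨ pr-neither n X Y (lengths (false , false) p eqX eqY) X<n Y<n ⟩
    twoColumns (map suc X) (map suc Y)
      ≡⟨ cong₂ twoColumns (map-suc-expand first 1 σ) (map-suc-expand second 1 σ) ⟩
    columnTableau ((false , false) ∷ σ) ∎
    where
    open ≡-Reasoning
    eqX = drop-none first (false , false) refl
    eqY = drop-none second (false , false) refl

  pr-state-first : ∀ {e} → Path 0 (singles (σ ∷ʳ (true , false))) e →
    pr n (columnTableau (σ ∷ʳ (true , false))) ≡ columnTableau ((true , false) ∷ σ)
  pr-state-first p = begin
    pr n (columnTableau (σ ∷ʳ (true , false)))
      ≡⟨ cong₂ (λ A B → pr n (twoColumns A B)) eqX eqY ⟩
    pr n (twoColumns (X ∷ʳ n) Y)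
      ≡⟨ pr-first n X Y (lengths (true , false) p eqX eqY) X<n Y<n ⟩
    twoColumns (1 ∷ map suc X) (map suc Y)
      ≡⟨ cong₂ (λ A B → twoColumns (1 ∷ A) B) (map-suc-expand first 1 σ)
        (map-suc-expand second 1 σ) ⟩
    columnTableau ((true , false) ∷ σ) ∎
    where
    open ≡-Reasoning
    eqX = snoc first (true , false)
    eqY = drop-none second (true , false) refl

  pr-state-both : ∀ {e} → Path 0 (singles (σ ∷ʳ (true , true))) e →
    pr n (columnTableau (σ ∷ʳ (true , true))) ≡ columnTableau ((true , true) ∷ σ)
  pr-state-both p = begin
    pr n (columnTableau (σ ∷ʳ (true , true)))
      ≡⟨ cong₂ (λ A B → pr n (twoColumns A B)) eqX eqY ⟩
    pr n (twoColumns (X ∷ʳ n) (Y ∷ʳ n))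
      ≡⟨ pr-both n X Y (lengths (true , true) p eqX eqY) X<n Y<n
           (path⇒dominated 1 σ (proj₁ (proj₂ (path-last σ (true , true) p)))) ⟩
    twoColumns (1 ∷ map suc X) (1 ∷ map suc Y)
      ≡⟨ cong₂ (λ A B → twoColumns (1 ∷ A) (1 ∷ B)) (map-suc-expand first 1 σ)
        (map-suc-expand second 1 σ) ⟩
    columnTableau ((true , true) ∷ σ) ∎
    where
    open ≡-Reasoning
    eqX = snoc first (true , true)
    eqY = snoc second (true , true)

-- Since `u` is balanced, `U` and `V` fill the same rows and `m` opens the next one. Below that row
-- the ballot property of `v` keeps the dot climbing; in the row of `m` the number above belongs to
-- `V`, hence is smaller than `m`, and the dot crosses. So `m` changes its column.
pr-state-second : ∀ u v {d e} → Path 0 (singles u) 0 → Path 0 (singles v) d →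
  let σ = u ++ (true , false) ∷ v in Path 0 (singles (σ ∷ʳ (false , true))) e →
  pr (suc (length σ)) (columnTableau (σ ∷ʳ (false , true)))
    ≡ columnTableau ((true , false) ∷ u ++ (false , true) ∷ v)
pr-state-second u v pu pv p = begin
  pr n (columnTableau (σ ∷ʳ (false , true)))
    ≡⟨ cong₂ (λ A B → pr n (twoColumns A B)) eqX eqY ⟩
  pr n (twoColumns (U ++ m ∷ X) ((V ++ Y) ∷ʳ n))
    ≡⟨ pr-second n U m X V Y (path-length 1 u pu) (expand-< second 1 u)
         (subst₂ (λ A B → length B ≤ length A) eqX eqY (path⇒length-≤ 1 (σ ∷ʳ (false , true)) p))
         (subst (All (_< n)) (expand-++ first 1 u _) (expand-< first 1 σ))
         (subst (All (_< n)) (expand-++ second 1 u _) (expand-< second 1 σ))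
         (path⇒dominated (suc m) v pv) ⟩
  twoColumns (1 ∷ map suc (U ++ X)) (map suc (V ++ m ∷ Y))
    ≡⟨ cong₂ (λ A B → twoColumns (1 ∷ map suc A) (map suc B)) (sym (expand-++ first 1 u _))
      (sym (expand-++ second 1 u _)) ⟩
  twoColumns (1 ∷ map suc (expand first 1 σ′)) (map suc (expand second 1 σ′))
    ≡⟨ cong₂ (λ A B → twoColumns (1 ∷ A) B) (map-suc-expand first 1 σ′)
      (map-suc-expand second 1 σ′) ⟩
  columnTableau ((true , false) ∷ σ′) ∎
  where
  open ≡-Reasoning
  σ = u ++ (true , false) ∷ v
  σ′ = u ++ (false , true) ∷ v
  n = suc (length σ)
  m = 1 + length u
  U = expand first 1 u
  V = expand second 1 u
  X = expand first (suc m) v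
  Y = expand second (suc m) v
  eqX : expand first 1 (σ ∷ʳ (false , true)) ≡ U ++ m ∷ X
  eqX = trans (expand-∷ʳ first 1 σ (false , true)) (trans (++-identityʳ _) (expand-++ first 1 u _))
  eqY : expand second 1 (σ ∷ʳ (false , true)) ≡ (V ++ Y) ∷ʳ n
  eqY = trans (expand-∷ʳ second 1 σ (false , true)) (cong (_∷ʳ n) (expand-++ second 1 u _))

columnCode-pr : ∀ {n} c z {w T} → ColumnCode n (c ∷ʳ z) w T →
  ColumnCode n (z ∷ c) (columnUpdate z w) (pr n T)
columnCode-pr c z (code σ len cσ (refl , _) refl) with map≡++ columnContent σ c [ z ] cσ
columnCode-pr {n} c _ (code _ len cσ (refl , e , p) refl) | σ , x ∷ [] , refl , refl , refl
  with trans (sym len) (length-∷ʳ σ x)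
... | refl = go x e p
  where
  go : ∀ x e → Path 0 (singles (σ ∷ʳ x)) e →
    ColumnCode (suc (length σ)) (columnContent x ∷ map columnContent σ)
      (columnUpdate (columnContent x) (singles (σ ∷ʳ x)))
        (pr (suc (length σ)) (columnTableau (σ ∷ʳ x)))
  go x e p with path-last σ x p
  go (false , false) e p | _ , q , done = code ((false , false) ∷ σ) refl refl
    (unchanged , e , p) (sym (pr-state-neither σ p))
    where
    unchanged : singles σ ≡ singles (σ ∷ʳ (false , false))
    unchanged = trans (sym (++-identityʳ _)) (sym (singles-++ σ _))
  go (true , true) e p | _ , q , done = code ((true , true) ∷ σ) refl refl
    (unchanged , e , p) (sym (pr-state-both σ p))
    where
    unchanged : singles σ ≡ singles (σ ∷ʳ (true , true))
    unchanged = trans (sym (++-identityʳ _)) (sym (singles-++ σ _))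
  go (true , false) e p | d , q , up done = code ((true , false) ∷ σ) refl refl
    (eq , suc d , subst (λ w → Path 0 w (suc d)) eq (up (path-lift q))) (sym (pr-state-first σ p))
    where
    eq : false ∷ singles σ ≡ promoteSingles (singles (σ ∷ʳ (true , false)))
    eq = sym (trans (cong promoteSingles (singles-++ σ _)) (promoteSingles-false (singles σ)))
  go (false , true) e p | suc e , q , down done with last-ascent 0 σ e q
  ... | inj₁ (u , v , refl , pu , pv) = code ((true , false) ∷ u ++ (false , true) ∷ v)
    (cong suc (trans (length-++ u) (sym (length-++ u))))
    (cong (1 ∷_) (trans (map-++ columnContent u _) (sym (map-++ columnContent u _))))
    -- The new leading `false` lifts `u` by one level, and the letter that changed column, now a
    -- descent, returns to the height 0 at which `v` starts.
    (eq , e , subst (λ w → Path 0 w e) (trans (cong (false ∷_) (sym (singles-++ u _))) eq)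
       (up (path-++ (path-lift pu) (down pv))))
    (sym (pr-state-second u v pu pv p))
    where
    eq : singles ((true , false) ∷ u ++ (false , true) ∷ v)
      ≡ promoteSingles (singles ((u ++ (true , false) ∷ v) ∷ʳ (false , true)))
    eq = sym (begin
      promoteSingles (singles ((u ++ (true , false) ∷ v) ∷ʳ (false , true)))
        ≡⟨ cong promoteSingles (trans (singles-++ (u ++ (true , false) ∷ v) _)
          (cong (_∷ʳ true) (singles-++ u _))) ⟩
      promoteSingles ((singles u ++ false ∷ singles v) ∷ʳ true)
        ≡⟨ promoteSingles-true pu pv ⟩
      false ∷ singles u ++ true ∷ singles v
        ≡⟨ cong (false ∷_) (singles-++ u _) ⟨
      singles ((true , false) ∷ u ++ (false , true) ∷ v) ∎)
      where open ≡-Reasoning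

-- Codes of semistandard two-column tableaux

rows-of-shape : ∀ (T : Tableau) sh → map length T ≡ sh → Linked _≥_ sh → All (1 ≤_) sh →
  All (_≤ 2) sh →
  All (Linked _≤_) T → ∃₂ λ X Y → T ≡ twoColumns X Y × Dominated X Y
rows-of-shape [] _ refl _ _ _ _ = [] , [] , refl , []
rows-of-shape ([] ∷ T) _ refl _ (() ∷ _) _ _
rows-of-shape ((_ ∷ _ ∷ _ ∷ _) ∷ T) _ refl _ _ (s≤s (s≤s ()) ∷ _) _
rows-of-shape ((x ∷ y ∷ []) ∷ T) _ refl l (_ ∷ p) (_ ∷ q) ((x≤y ∷ _) ∷ r)
  with rows-of-shape T _ refl (Linked.tail l) p q r
... | X , Y , refl , d = x ∷ X , y ∷ Y , refl , x≤y ∷ d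
-- Below a row of length 1 all rows have length 1, so what remains is the tail of the first column.
rows-of-shape ((x ∷ []) ∷ T) _ refl l (_ ∷ p) _ _
  with column-of-shape (length T) T (ones T (All.map⁻ (below l)) (All.map⁻ p))
  where
  below : ∀ {k ks} → Linked _≥_ (k ∷ ks) → All (_≤ k) ks
  below [-]       = []
  below (k≥j ∷ l) = Linked⇒All (λ a b → ≤-trans b a) k≥j l
  ones : ∀ (T : Tableau) → All (λ r → length r ≤ 1) T → All (λ r → 1 ≤ length r) T →
    map length T ≡ replicate (length T) 1
  ones []      _        _        = refl
  ones (r ∷ T) (p ∷ ps) (q ∷ qs) = cong₂ _∷_ (≤-antisym p q) (ones T ps qs)
... | L , refl = x ∷ L , [] , refl , []

column-code : ∀ {n X Y} → Linked _<_ X → All (λ y → 1 ≤ y × y ≤ n) X →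
  Linked _<_ Y → All (λ y → 1 ≤ y × y ≤ n) Y → Dominated X Y →
  ∃₂ λ c w → ColumnCode n c w (twoColumns X Y)
column-code {n} lX rX lY rY d
  with states first second {P = _≤ 1} {Q = _≤ 1} mk n (Linked.map <⇒≤ lX) rX (strict lX)
    (Linked.map <⇒≤ lY) rY (strict lY)
  where
  strict : ∀ {xs} → Linked _<_ xs → ∀ as → expand id 1 as ≡ xs → All (_≤ 1) as
  strict l as eq = multiplicities-≤1 1 as (subst (Linked _<_) (sym eq) l)
  boolean : ∀ {a} → a ≤ 1 → ∃ λ b → bit b ≡ a
  boolean {zero}  _         = false , refl
  boolean {suc _} (s≤s z≤n) = true , refl
  mk : ∀ {a b} → a ≤ 1 → b ≤ 1 → ∃ λ x → first x ≡ a × second x ≡ b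
  mk p q with boolean p | boolean q
  ... | a , eq | b , eq′ = (a , b) , eq , eq′
... | σ , len , refl , refl = _ , _ , code σ len refl (refl , dominated⇒path 0 1 σ d) refl

column-coded : ∀ {n sh T} → IsPartition sh → IsTwoColumn sh → IsSST n sh T → ∃₂ λ c w →
  ColumnCode n c w T
column-coded {sh = _ ∷ sh} {T} (l , p) refl sst
  with rows-of-shape T _ (IsSST.shape sst) l p (Linked⇒All (λ a b → ≤-trans b a) ≤-refl l)
    (IsSST.rows sst)
... | X , Y , refl , d = column-code
  (entries⇒linked X (λ r x y p q → IsSST.columns sst r 0 x y
    (trans (entry-first X Y r) p) (trans (entry-first X Y (suc r)) q)))
  (all-attach X (attach Y []) (IsSST.range sst))
  (entries⇒linked Y (λ r x y p q → IsSST.columns sst r 1 x y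
    (trans (entry-second X Y Y≤X r) p) (trans (entry-second X Y Y≤X (suc r)) q)))
  (all-attach Y [] (all-attach-rest X (attach Y [])
    (subst (_≤ length X) (sym (length-attach Y [])) Y≤X) (IsSST.range sst)))
  d
  where Y≤X = dominated-length d

lemma4p5 : (n : ℕ) → 2 ≤ n →
    (sh : List ℕ) → IsPartition sh → length sh < n →
    IsHook sh ⊎ IsTwoColumn sh →
    ((i : ℕ) → 1 ≤ i → i < n →
    (T : Tableau) → IsSST n sh T → s i (prⁿ n T) ≡ prⁿ n (s i T))
    × ((T : Tableau) → IsSST n sh T → cox n (prⁿ n T) ≡ prⁿ n (cox n T))
lemma4p5 n _ sh _ _ (inj₁ hookShape) =
  (λ i 1≤i i<n T sst → proj₂ (C.s-prⁿ i 1≤i i<n (hook-coded hookShape sst))) ,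
  (λ T sst → C.cox-prⁿ (hook-coded hookShape sst))
  where
  module C = Commutation n (HookCode n) hookUpdate hookUpdate-comm
    hookCode-length hookCode-unique hookCode-s hookCode-pr
lemma4p5 n _ sh partition _ (inj₂ twoColumn) =
  (λ i 1≤i i<n T sst → proj₂ (C.s-prⁿ i 1≤i i<n (column-coded partition twoColumn sst))) ,
  (λ T sst → C.cox-prⁿ (column-coded partition twoColumn sst))
  where
  module C = Commutation n (ColumnCode n) columnUpdate columnUpdate-comm
    columnCode-length columnCode-unique columnCode-s columnCode-pr
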